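{- The closest pair among a dynamic set of $n$ objects can be maintained in time $O(n)$ per insertion or deletion, and $O(n^2)$ space.
   Context: Model of computation: one maintains a finite set of objects subject to insertions and deletions, together with a (symmetric) bivariate function $d(s,t)$ giving the distance between two objects. The values of $d$ are only assumed to be totally ordered; no triangle inequality or other property is assumed. Each object is stored in constant space, $d$ can be evaluated in constant time, and two distances can be compared in constant time. Maintaining the closest pair means that after each update the data structure provides a pair of distinct objects $s,t$ in the current set minimizing $d(s,t)$; if several pairs attain the minimum, any one of them may be returned. Here $n$ is the current number of objects. -}

module Defs where

open import Level using (_⊔_) renaming (suc to lsuc)
open import Data.Bool.Base using (Bool; true; false; not; if_then_else_) renaming (_∧_ to _∧ᵇ_)
open import Data.List.Base using (List; []; _∷_; _++_)
open import Data.List.Membership.Propositional using (_∈_; _∉_)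
open import Data.List.Relation.Unary.Any using (_─_)
open import Data.Maybe.Base using (Maybe; just; nothing; zipWith)
open import Data.Maybe.Properties using (≡-dec)
open import Data.Nat as ℕ using (ℕ; zero; suc; _+_; _∸_; _*_; _^_; _≤_; _≤ᵇ_; _≡ᵇ_)
open import Data.Product.Base using (_×_; _,_; ∃₂)
open import Relation.Binary.Bundles using (DecTotalOrder)
open import Relation.Binary.Definitions using (DecidableEquality)
open import Relation.Binary.PropositionalEquality using (_≡_; _≢_; refl; sym; trans)
open import Relation.Nullary.Decidable.Core using (⌊_⌋)

-- Equality of objects and the order on distances are decidable because the
-- machine below performs both tests as unit-time operations.
record DistanceSpace a c ℓ₁ ℓ₂ : Set (lsuc (a ⊔ c ⊔ ℓ₁ ⊔ ℓ₂)) where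
  field
    Object : Set a
    _≟_    : DecidableEquality Object
    order  : DecTotalOrder c ℓ₁ ℓ₂

  open DecTotalOrder order public
    using () renaming (Carrier to Distance; _≈_ to _≈ᵈ_; _≤_ to _≤ᵈ_; _≤?_ to _≤?ᵈ_)

  field
    d     : Object → Object → Distance
    d-sym : ∀ s t → d s t ≈ᵈ d t s

-- Programs for a random access machine with three banks of cells, holding
-- words, objects and distances.  There are no registers apart from the memory:
-- the cells with literal addresses play that role.  A program cannot inspect
-- objects and distances except through δ, ≐ᵒ and ≤ᵈ, and does not depend on the
-- distance space.

infixl 6 _⊕_ _⊖_
infixl 7 _⊗_ _⊘_

data WordExpr : Set where
  lit             : ℕ → WordExpr
  word[_]         : WordExpr → WordExpr
  _⊕_ _⊖_ _⊗_ _⊘_ : WordExpr → WordExpr → WordExpr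

data ObjectExpr : Set where
  blank     : ObjectExpr
  object[_] : WordExpr → ObjectExpr

data DistanceExpr : Set where
  blank       : DistanceExpr
  distance[_] : WordExpr → DistanceExpr
  δ           : ObjectExpr → ObjectExpr → DistanceExpr

infix 4 _≤ʷ_ _≐ᵒ_ _≤ᵈ_
infixr 3 _∧_

data Test : Set where
  _≤ʷ_ : WordExpr → WordExpr → Test
  _≐ᵒ_ : ObjectExpr → ObjectExpr → Test
  _≤ᵈ_ : DistanceExpr → DistanceExpr → Test
  ¬ᵗ_  : Test → Test
  _∧_  : Test → Test → Test

infix  2 word[_]≔_ object[_]≔_ distance[_]≔_
infixr 1 _⨾_

data Program : Set where
  skip          : Program
  word[_]≔_     : WordExpr → WordExpr → Program
  object[_]≔_   : WordExpr → ObjectExpr → Program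
  distance[_]≔_ : WordExpr → DistanceExpr → Program
  _⨾_           : Program → Program → Program
  cond          : Test → Program → Program → Program
  while         : Test → Program → Program

record Algorithm : Set where
  field
    insertion deletion : Program

-- m ∸ n and m / 0 = 0 make word arithmetic total.
quotient : ℕ → ℕ → ℕ
quotient m zero    = 0
quotient m (suc n) = m ℕ./ suc n

_[_↦_] : ∀ {a} {A : Set a} → (ℕ → A) → ℕ → A → (ℕ → A)
(f [ i ↦ v ]) j = if i ≡ᵇ j then v else f j

module Machine {a c ℓ₁ ℓ₂} (X : DistanceSpace a c ℓ₁ ℓ₂) where
  open DistanceSpace X using (Object; _≟_; Distance; _≤?ᵈ_; d) renaming (_≤ᵈ_ to _≤ₓ_)

  record State : Set (a ⊔ c) where
    field
      word     : ℕ → ℕ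
      object   : ℕ → Maybe Object
      distance : ℕ → Maybe Distance
  open State

  initial : State
  initial = record { word = λ _ → 0 ; object = λ _ → nothing ; distance = λ _ → nothing }

  ⟦_⟧ʷ : WordExpr → State → ℕ
  ⟦ lit n     ⟧ʷ σ = n
  ⟦ word[ e ] ⟧ʷ σ = word σ (⟦ e ⟧ʷ σ)
  ⟦ e ⊕ f     ⟧ʷ σ = ⟦ e ⟧ʷ σ + ⟦ f ⟧ʷ σ
  ⟦ e ⊖ f     ⟧ʷ σ = ⟦ e ⟧ʷ σ ∸ ⟦ f ⟧ʷ σ
  ⟦ e ⊗ f     ⟧ʷ σ = ⟦ e ⟧ʷ σ * ⟦ f ⟧ʷ σ
  ⟦ e ⊘ f     ⟧ʷ σ = quotient (⟦ e ⟧ʷ σ) (⟦ f ⟧ʷ σ)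

  ⟦_⟧ᵒ : ObjectExpr → State → Maybe Object
  ⟦ blank       ⟧ᵒ σ = nothing
  ⟦ object[ e ] ⟧ᵒ σ = object σ (⟦ e ⟧ʷ σ)

  ⟦_⟧ᵈ : DistanceExpr → State → Maybe Distance
  ⟦ blank         ⟧ᵈ σ = nothing
  ⟦ distance[ e ] ⟧ᵈ σ = distance σ (⟦ e ⟧ʷ σ)
  ⟦ δ e f         ⟧ᵈ σ = zipWith d (⟦ e ⟧ᵒ σ) (⟦ f ⟧ᵒ σ)

  -- A blank distance compares as +∞.
  leq : Maybe Distance → Maybe Distance → Bool
  leq _        nothing  = true
  leq nothing  (just _) = false
  leq (just x) (just y) = ⌊ x ≤?ᵈ y ⌋

  ⟦_⟧ᵗ : Test → State → Bool
  ⟦ e ≤ʷ f ⟧ᵗ σ = ⟦ e ⟧ʷ σ ≤ᵇ ⟦ f ⟧ʷ σ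
  ⟦ e ≐ᵒ f ⟧ᵗ σ = ⌊ ≡-dec _≟_ (⟦ e ⟧ᵒ σ) (⟦ f ⟧ᵒ σ) ⌋
  ⟦ e ≤ᵈ f ⟧ᵗ σ = leq (⟦ e ⟧ᵈ σ) (⟦ f ⟧ᵈ σ)
  ⟦ ¬ᵗ b   ⟧ᵗ σ = not (⟦ b ⟧ᵗ σ)
  ⟦ b ∧ b′ ⟧ᵗ σ = ⟦ b ⟧ᵗ σ ∧ᵇ ⟦ b′ ⟧ᵗ σ

  setWord : ℕ → ℕ → State → State
  setWord i v σ = record σ { word = word σ [ i ↦ v ] }

  setObject : ℕ → Maybe Object → State → State
  setObject i v σ = record σ { object = object σ [ i ↦ v ] }

  setDistance : ℕ → Maybe Distance → State → State
  setDistance i v σ = record σ { distance = distance σ [ i ↦ v ] }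

  -- Run p σ τ σ′: started in σ, program p halts in σ′, and τ lists the states
  -- after each of its steps.  Every assignment and every evaluated test is one
  -- step, so length τ is the running time; the expressions in a fixed program
  -- have bounded size, so a step amounts to boundedly many machine operations.
  data Run : Program → State → List State → State → Set (a ⊔ c) where
    skip : ∀ {σ} →
      Run skip σ (σ ∷ []) σ
    word≔ : ∀ {e f σ} → let σ′ = setWord (⟦ e ⟧ʷ σ) (⟦ f ⟧ʷ σ) σ in
      Run (word[ e ]≔ f) σ (σ′ ∷ []) σ′
    object≔ : ∀ {e f σ} → let σ′ = setObject (⟦ e ⟧ʷ σ) (⟦ f ⟧ᵒ σ) σ in
      Run (object[ e ]≔ f) σ (σ′ ∷ []) σ′
    distance≔ : ∀ {e f σ} → let σ′ = setDistance (⟦ e ⟧ʷ σ) (⟦ f ⟧ᵈ σ) σ in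
      Run (distance[ e ]≔ f) σ (σ′ ∷ []) σ′
    seq : ∀ {p q σ σ′ σ″ τ τ′} →
      Run p σ τ σ′ → Run q σ′ τ′ σ″ → Run (p ⨾ q) σ (τ ++ τ′) σ″
    cond-true : ∀ {b p q σ σ′ τ} →
      ⟦ b ⟧ᵗ σ ≡ true → Run p σ τ σ′ → Run (cond b p q) σ (σ ∷ τ) σ′
    cond-false : ∀ {b p q σ σ′ τ} →
      ⟦ b ⟧ᵗ σ ≡ false → Run q σ τ σ′ → Run (cond b p q) σ (σ ∷ τ) σ′
    while-true : ∀ {b p σ σ′ σ″ τ τ′} →
      ⟦ b ⟧ᵗ σ ≡ true → Run p σ τ σ′ → Run (while b p) σ′ τ′ σ″ →
      Run (while b p) σ (σ ∷ τ ++ τ′) σ″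
    while-false : ∀ {b p σ} →
      ⟦ b ⟧ᵗ σ ≡ false → Run (while b p) σ (σ ∷ []) σ

  Run-deterministic : ∀ {p σ τ₁ τ₂ σ₁ σ₂} →
    Run p σ τ₁ σ₁ → Run p σ τ₂ σ₂ → τ₁ ≡ τ₂ × σ₁ ≡ σ₂
  Run-deterministic skip      skip      = refl , refl
  Run-deterministic word≔     word≔     = refl , refl
  Run-deterministic object≔   object≔   = refl , refl
  Run-deterministic distance≔ distance≔ = refl , refl
  Run-deterministic (seq r s) (seq r′ s′) with refl , refl ← Run-deterministic r r′
    with refl , refl ← Run-deterministic s s′ = refl , refl
  Run-deterministic (cond-true _ r) (cond-true _ r′)
    with refl , refl ← Run-deterministic r r′ = refl , refl
  Run-deterministic (cond-true t _) (cond-false f _) with () ← trans (sym t) f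
  Run-deterministic (cond-false f _) (cond-true t _) with () ← trans (sym t) f
  Run-deterministic (cond-false _ r) (cond-false _ r′)
    with refl , refl ← Run-deterministic r r′ = refl , refl
  Run-deterministic (while-true _ r s) (while-true _ r′ s′)
    with refl , refl ← Run-deterministic r r′
    with refl , refl ← Run-deterministic s s′ = refl , refl
  Run-deterministic (while-true t _ _) (while-false f) with () ← trans (sym t) f
  Run-deterministic (while-false f) (while-true t _ _) with () ← trans (sym t) f
  Run-deterministic (while-false _) (while-false _) = refl , refl

  -- At most k (1 + n²) cells of each bank are in use: everything further up is
  -- blank, so nothing is retained there, even while the set shrinks.  A word
  -- has O(log n) bits, which rules out packing many numbers into one cell.
  record Within (k n : ℕ) (σ : State) : Set (a ⊔ c) where
    field
      word-blank     : ∀ i → k * (1 + n ^ 2) ≤ i → word σ i ≡ 0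
      object-blank   : ∀ i → k * (1 + n ^ 2) ≤ i → object σ i ≡ nothing
      distance-blank : ∀ i → k * (1 + n ^ 2) ≤ i → distance σ i ≡ nothing
      word-small     : ∀ i → word σ i ≤ (2 + n) ^ k

  data Update : Set a where
    insert delete : Object → Update

  -- The current set is a duplicate-free list: only new objects are inserted.
  infix 4 _─⟨_⟩→_
  data _─⟨_⟩→_ : List Object → Update → List Object → Set a where
    insert : ∀ {S x} → x ∉ S → S ─⟨ insert x ⟩→ x ∷ S
    delete : ∀ {S x} (x∈S : x ∈ S) → S ─⟨ delete x ⟩→ (S ─ x∈S)

  program : Algorithm → Update → Program
  program A (insert _) = Algorithm.insertion A
  program A (delete _) = Algorithm.deletion A

  -- The updated object is passed in object cell 0.
  supply : Update → State → State
  supply (insert x) = setObject 0 (just x)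
  supply (delete x) = setObject 0 (just x)

  Performs : Algorithm → Update → State → List State → State → Set (a ⊔ c)
  Performs A u σ = Run (program A u) (supply u σ)

  data Reachable (A : Algorithm) : List Object → State → Set (a ⊔ c) where
    start  : Reachable A [] initial
    update : ∀ {S S′ σ σ′ τ u} → Reachable A S σ → S ─⟨ u ⟩→ S′ →
      Performs A u σ τ σ′ → Reachable A S′ σ′

  record IsClosestPair (S : List Object) (s t : Object) : Set (a ⊔ ℓ₂) where
    field
      s∈S      : s ∈ S
      t∈S      : t ∈ S
      distinct : s ≢ t
      minimal  : ∀ {u v} → u ∈ S → v ∈ S → u ≢ v → d s t ≤ₓ d u v

  -- The answer is delivered in object cells 1 and 2.
  Provides : State → List Object → Set (a ⊔ ℓ₂)
  Provides σ S = ∃₂ λ s t → object σ 1 ≡ just s × object σ 2 ≡ just t × IsClosestPair S s t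

{-# OPTIONS --safe #-}
module Submission where

open import Defs
open import Level using (_⊔_)
open import Data.Bool.Base using (Bool; true; false; not; if_then_else_; T) renaming (_∧_ to _∧ᵇ_)
open import Data.Bool.Properties using (T-≡)
open import Data.Fin.Base using (Fin; toℕ)
open import Data.Fin.Patterns using (0F; 1F)
open import Data.Fin.Properties using (toℕ<n)
open import Data.List.Base using (List; []; _∷_; length)
open import Data.List.Membership.Propositional using (_∈_)
open import Data.List.Properties using (length-++; length-removeAt′)
open import Data.List.Relation.Unary.All as All using (All; []; _∷_)
open import Data.List.Relation.Unary.All.Properties using (++⁺; ¬Any⇒All¬; All¬⇒¬Any)
open import Data.List.Relation.Unary.AllPairs using ([]; _∷_)
open import Data.List.Relation.Unary.Any using (here; there; index; _─_)
open import Data.List.Relation.Unary.Unique.Propositional using (Unique)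
open import Data.Maybe.Base using (Maybe; just; nothing; zipWith)
open import Data.Maybe.Properties using (≡-dec; just-injective)
open import Data.Nat hiding (_⊔_)
open import Data.Nat.DivMod using (_/_; _%_; m%n<n; m≡m%n+[m/n]*n; m/n*n≤m; m/n≤m; m*n/n≡m; m/n≡1+[m∸n]/n; /-monoˡ-≤)
open import Data.Nat.Properties
open import Data.Nat.Tactic.RingSolver using (solve-∀)
open import Data.Product using (_×_; _,_; proj₁; proj₂; ∃; ∃₂; ∃-syntax)
open import Data.Sum.Base using (_⊎_; inj₁; inj₂; map₂)
open import Function.Bundles using (Equivalence)
open import Relation.Binary.Bundles using (DecTotalOrder)
open import Relation.Binary.Definitions using (tri<; tri≈; tri>)
open import Relation.Binary.PropositionalEquality
open import Relation.Nullary
open import Relation.Nullary.Decidable using (dec-true; isYes≗does; _×-dec_)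

-- The matrix of distances is covered by a quadtree: the entry (l , i , j) holds
-- a closest pair between the blocks i and j of 2 ^ l consecutive objects, and is
-- the best of four entries of level l - 1.  Changing one object affects one row
-- and one column per level, and the widths n, n / 2, n / 4, ... sum to O(n).
-- A deletion moves the last object into the gap, so that the objects always
-- occupy the positions below n and all entries beyond them are blank.

-- Blocks

-- The bounds must hold after every single step and in terms of the size after the update, also
-- while the set shrinks, so no room can be reserved for a maximal size. Hence no capacity enters an
-- address: the blocks of all levels are numbered once and for all, two numbers are combined by a
-- quadratic injection, and cells that fall out of range are blanked. The invariant can then speak
-- of all levels and blocks at once, since entries never written are correct as they are. An entry
-- is recomputed from its four children instead of being compared with its former value, so losing a
-- minimum costs no more than gaining one. The obstacle is block 0, which is nonempty on every
-- level: its entry with itself would need arbitrarily large addresses. It lives in the answer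
-- cells, for the current level only, and is the answer once a single block is left. Correctness
-- rests on one statement: tables that are right for one listing become right for any other listing
-- that differs at one position. An insertion is one such change, a deletion two.

half-even : ∀ i → 2 * i / 2 ≡ i
half-even i = trans (cong (_/ 2) (*-comm 2 i)) (m*n/n≡m i 2)

half-odd : ∀ i → (1 + 2 * i) / 2 ≡ i
half-odd zero    = refl
half-odd (suc i) = begin
  (1 + 2 * suc i) / 2          ≡⟨ m/n≡1+[m∸n]/n {1 + 2 * suc i} {2} (s≤s (s≤s z≤n)) ⟩
  1 + (1 + 2 * suc i ∸ 2) / 2  ≡⟨ cong (λ m → 1 + (m ∸ 2) / 2) (odd-suc i) ⟩
  1 + (1 + 2 * i) / 2          ≡⟨ cong suc (half-odd i) ⟩
  suc i                        ∎
  where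
  open ≡-Reasoning
  odd-suc : ∀ i → 1 + 2 * suc i ≡ 2 + (1 + 2 * i)
  odd-suc = solve-∀

halves : ∀ m → m ≡ 2 * (m / 2) ⊎ m ≡ 1 + 2 * (m / 2)
halves m with m % 2 | m%n<n m 2 | m≡m%n+[m/n]*n m 2
... | 0           | _                 | eq = inj₁ (trans eq (*-comm (m / 2) 2))
... | 1           | _                 | eq = inj₂ (trans eq (cong suc (*-comm (m / 2) 2)))
... | suc (suc _) | s≤s (s≤s ())      | _

≤-half : ∀ {w i} → (1 + w) / 2 ≤ i → w ≤ 2 * i
≤-half {w} {i} h with halves (1 + w)
... | inj₁ eq = ≤-trans (n≤1+n w) (≤-trans (≤-reflexive eq) (*-monoʳ-≤ 2 h))
... | inj₂ eq = ≤-trans (≤-reflexive (suc-injective eq)) (*-monoʳ-≤ 2 h)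

<-half : ∀ {w i} → i < (1 + w) / 2 → 2 * i < w
<-half {w} {i} h = s≤s⁻¹ (begin
  2 + 2 * i          ≡⟨ *-suc 2 i ⟨
  2 * suc i          ≤⟨ *-monoʳ-≤ 2 h ⟩
  2 * ((1 + w) / 2)  ≡⟨ *-comm 2 ((1 + w) / 2) ⟩
  (1 + w) / 2 * 2    ≤⟨ m/n*n≤m (1 + w) 2 ⟩
  1 + w              ∎)
  where open ≤-Reasoning

half-< : ∀ {a w} → a < w → a / 2 < (1 + w) / 2
half-< {a} {w} a<w = ≰⇒> λ h → <⇒≱ a<w (begin
  w            ≤⟨ ≤-half h ⟩
  2 * (a / 2)  ≡⟨ *-comm 2 (a / 2) ⟩
  a / 2 * 2    ≤⟨ m/n*n≤m a 2 ⟩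
  a            ∎)
  where open ≤-Reasoning

-- Objects p with ancestor l p ≡ i form block i of level l; with N objects in
-- use, the blocks i < width l N are the nonempty ones.
ancestor width : ℕ → ℕ → ℕ
ancestor zero    p = p
ancestor (suc l) p = ancestor l p / 2
width zero    N = N
width (suc l) N = (1 + width l N) / 2

ancestor<width : ∀ l {p N} → p < N → ancestor l p < width l N
ancestor<width zero    p<N = p<N
ancestor<width (suc l) p<N = half-< (ancestor<width l p<N)

-- `2 ^ l * i` is the first position of block `i`, so a nonempty block starts below `N`. Bounds on
-- addresses and on the register `scale` go back to this.
width-scaled : ∀ l {i N} → i < width l N → 2 ^ l * i < N
width-scaled zero    {i} {N} i<w = subst (_< N) (sym (*-identityˡ i)) i<w
width-scaled (suc l) {i} {N} i<w = subst (_< N) (move (2 ^ l) i) (width-scaled l (<-half i<w))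
  where
  move : ∀ x i → x * (2 * i) ≡ 2 * x * i
  move = solve-∀

width≤ : ∀ l N → width l N ≤ N
width≤ l N with width l N in eq
... | zero  = z≤n
... | suc i = ≤-trans (s≤s (m≤n*m i (2 ^ l) {{m^n≢0 2 l}})) (width-scaled l (≤-reflexive (sym eq)))

-- Addresses

-- Cantor's pairing with a square in place of the triangular number: still injective and quadratic,
-- and, unlike row-major order, independent of the size of the array.
cell : ℕ → ℕ → ℕ
cell u v = (u + v) * (u + v) + u

cell-mono : ∀ {u v u′ v′} → u ≤ u′ → v ≤ v′ → cell u v ≤ cell u′ v′
cell-mono p q = +-mono-≤ (*-mono-≤ (+-mono-≤ p q) (+-mono-≤ p q)) p

private
  -- cell u v lies between (u + v) ^ 2 and (u + v + 1) ^ 2.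
  cell-sum : ∀ u v u′ v′ → u + v < u′ + v′ → cell u v < cell u′ v′
  cell-sum u v u′ v′ lt = begin-strict
    cell u v                           ≤⟨ +-monoʳ-≤ ((u + v) * (u + v)) (m≤m+n u v) ⟩
    (u + v) * (u + v) + (u + v)        <⟨ square (u + v) ⟩
    suc (u + v) * suc (u + v)          ≤⟨ *-mono-≤ lt lt ⟩
    (u′ + v′) * (u′ + v′)              ≤⟨ m≤m+n _ u′ ⟩
    cell u′ v′                         ∎
    where
    open ≤-Reasoning
    square : ∀ t → t * t + t < suc t * suc t
    square t = ≤-trans (m≤m+n _ t) (≤-reflexive (identity t))
      where
      identity : ∀ t → suc (t * t + t) + t ≡ suc t * suc t
      identity = solve-∀

cell-injective : ∀ {u v u′ v′} → cell u v ≡ cell u′ v′ → u ≡ u′ × v ≡ v′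
cell-injective {u} {v} {u′} {v′} eq with <-cmp (u + v) (u′ + v′)
... | tri< lt _ _ = contradiction eq (<⇒≢ (cell-sum u v u′ v′ lt))
... | tri> _ _ gt = contradiction (sym eq) (<⇒≢ (cell-sum u′ v′ u v gt))
... | tri≈ _ same _ = u≡u′ , +-cancelˡ-≡ u v v′ (trans same (cong (_+ v′) (sym u≡u′)))
  where
  u≡u′ : u ≡ u′
  u≡u′ = +-cancelˡ-≡ ((u + v) * (u + v)) u u′ (trans eq (cong (λ t → t * t + u′) (sym same)))

-- Numbers the blocks of all levels injectively, and those that are nonempty for
-- N objects by O(N).
code : ℕ → ℕ → ℕ
code l i = 2 ^ l * (1 + 2 * i)

code>0 : ∀ l i → 0 < code l i
code>0 l i = *-mono-≤ (m^n>0 2 l) (s≤s z≤n)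

private
  double : ∀ x y → 2 * x * y ≡ 2 * (x * y)
  double = solve-∀

-- A positive number is a power of two times an odd number in only one way: parity tells level 0
-- from the others, and otherwise a factor 2 cancels.
code-injective : ∀ l l′ {i i′} → code l i ≡ code l′ i′ → l ≡ l′ × i ≡ i′
code-injective zero zero {i} {i′} eq = refl ,
  *-cancelˡ-≡ i i′ 2 (suc-injective (trans (sym (*-identityˡ _)) (trans eq (*-identityˡ _))))
code-injective zero (suc l′) {i} {i′} eq = contradiction
  (trans (sym (double (2 ^ l′) _)) (trans (sym eq) (*-identityˡ _))) (even≢odd (code l′ i′) i)
code-injective (suc l) zero {i} {i′} eq = contradiction
  (trans (sym (double (2 ^ l) _)) (trans eq (*-identityˡ _))) (even≢odd (code l i) i′)
code-injective (suc l) (suc l′) {i} {i′} eq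
  with refl , i≡i′ ← code-injective l l′ (*-cancelˡ-≡ (code l i) (code l′ i′) 2
         (trans (sym (double (2 ^ l) _)) (trans eq (double (2 ^ l′) _)))) = refl , i≡i′

bit-injective : ∀ (b b′ : Fin 2) {x y} → toℕ b + 2 * x ≡ toℕ b′ + 2 * y → b ≡ b′ × x ≡ y
bit-injective 0F 0F eq = refl , *-cancelˡ-≡ _ _ 2 eq
bit-injective 0F 1F {x} {y} eq = contradiction eq (even≢odd x y)
bit-injective 1F 0F {x} {y} eq = contradiction (sym eq) (even≢odd y x)
bit-injective 1F 1F eq = refl , *-cancelˡ-≡ _ _ 2 (suc-injective eq)

-- A pair takes two cells, told apart by b.  Codes are positive, which leaves the
-- cells in row 0 free for the enumeration of the objects.
opaque
  slot : ℕ → ℕ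
  slot i = cell 0 (2 + i)

  entry : Fin 2 → ℕ → ℕ → ℕ → ℕ
  entry b l i j = cell (toℕ b + 2 * code l i) (code l j)

  slot-injective : ∀ {i j} → slot i ≡ slot j → i ≡ j
  slot-injective eq = +-cancelˡ-≡ 2 _ _ (proj₂ (cell-injective {0} {_} {0} eq))

  entry-injective : ∀ {b l i j b′ l′ i′ j′} → entry b l i j ≡ entry b′ l′ i′ j′ →
    b ≡ b′ × l ≡ l′ × i ≡ i′ × j ≡ j′
  entry-injective {b} {l} {i} {j} {b′} {l′} {i′} {j′} eq
    with rows , columns ← cell-injective {toℕ b + 2 * code l i} eq
    with refl , rows ← bit-injective b b′ rows
    with refl , i≡i′ ← code-injective l l′ rows = refl , refl , i≡i′ , proj₂ (code-injective l l columns)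

  slot≢entry : ∀ {k b l i j} → slot k ≢ entry b l i j
  slot≢entry {k} {b} {l} {i} eq = <⇒≢ (≤-trans (code>0 l i) (≤-trans (m≤n*m (code l i) 2) (m≤n+m _ (toℕ b))))
    (proj₁ (cell-injective {0} {2 + k} eq))

  -- This is the purpose of the shift by 2 in `slot`: `cell 0 0` and `cell 0 1` are the addresses 0
  -- and 1, which belong to the input and the answer.
  3≤slot : ∀ i → 3 ≤ slot i
  3≤slot i = ≤-trans (s≤s (s≤s (s≤s z≤n))) (cell-mono {0} {2} {0} {2 + i} z≤n (m≤m+n 2 i))

  3≤entry : ∀ b l i j → 3 ≤ entry b l i j
  3≤entry b l i j = ≤-trans (s≤s (s≤s (s≤s z≤n)))
    (cell-mono (≤-trans (*-monoʳ-≤ 2 (code>0 l i)) (m≤n+m (2 * code l i) (toℕ b))) (code>0 l j))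

data Used (N : ℕ) : ℕ → Set where
  reserved : ∀ {c} → c < 3 → Used N c
  slotted  : ∀ {i} → i < N → Used N (slot i)
  entered  : ∀ b l {i j} → i < width l N → j < width l N → 1 ≤ i + j → Used N (entry b l i j)

-- If there are two nonempty blocks, block 1 starts at `2 ^ l`, which is therefore below `N`. With
-- block 0 alone nothing would bound the level.
code-bound : ∀ l {i N} → i < width l N → 1 < width l N → code l i ≤ 3 * N
code-bound l {i} {N} i<w 1<w = begin
  2 ^ l * (1 + 2 * i)              ≡⟨ split (2 ^ l) i ⟩
  2 ^ l * 1 + 2 * (2 ^ l * i)      ≤⟨ +-mono-≤ (<⇒≤ (width-scaled l 1<w)) (*-monoʳ-≤ 2 (<⇒≤ (width-scaled l i<w))) ⟩
  3 * N                            ∎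
  where
  open ≤-Reasoning
  split : ∀ x i → x * (1 + 2 * i) ≡ x * 1 + 2 * (x * i)
  split = solve-∀

1<width : ∀ {i j w} → i < w → j < w → 1 ≤ i + j → 1 < w
1<width {zero}  i<w j<w h = ≤-<-trans h j<w
1<width {suc _} i<w j<w h = ≤-<-trans (s≤s z≤n) i<w

opaque
  unfolding slot entry

  -- `N` is the number of positions in use during an update and `n` the size after it; a deletion
  -- has `N ≡ 1 + n`. The farthest conceivable cell, in row `1 + 6 * (1 + n)` and column
  -- `3 * (1 + n)`, has an address quadratic in `n` with coefficients 81, 186 and 107; 300 leaves
  -- some slack.
  Used-bound : ∀ {n N c} → N ≤ 1 + n → Used N c → c < 300 * (1 + n ^ 2)
  Used-bound {n} {N} N≤ used = ≤-<-trans (below used) final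
    where
    open ≤-Reasoning
    codes : ∀ l {i} → i < width l N → 1 < width l N → code l i ≤ 3 * (1 + n)
    codes l i<w 1<w = ≤-trans (code-bound l i<w 1<w) (*-monoʳ-≤ 3 N≤)
    below : ∀ {c} → Used N c → c ≤ cell (1 + 2 * (3 * (1 + n))) (3 * (1 + n))
    below (reserved c<3) = ≤-trans (≤-pred c<3)
      (cell-mono {1} {0} {1 + 2 * (3 * (1 + n))} {3 * (1 + n)} (m≤m+n 1 _) z≤n)
    below (slotted {i} i<N) = cell-mono {0} {2 + i} {1 + 2 * (3 * (1 + n))} {3 * (1 + n)} z≤n (begin
      2 + i            ≤⟨ s≤s (≤-trans i<N N≤) ⟩
      1 + (1 + n)      ≤⟨ m≤m+n _ (1 + 2 * n) ⟩
      2 + n + (1 + 2 * n) ≡⟨ triple n ⟩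
      3 * (1 + n)      ∎)
      where
      triple : ∀ n → 2 + n + (1 + 2 * n) ≡ 3 * (1 + n)
      triple = solve-∀
    below (entered b l i<w j<w h) = cell-mono
      (+-mono-≤ (≤-pred (toℕ<n b)) (*-monoʳ-≤ 2 (codes l i<w (1<width i<w j<w h))))
      (codes l j<w (1<width i<w j<w h))
    final : cell (1 + 2 * (3 * (1 + n))) (3 * (1 + n)) < 300 * (1 + n ^ 2)
    final = begin-strict
      cell (1 + 2 * (3 * (1 + n))) (3 * (1 + n))  ≡⟨ expand n ⟩
      81 * n ^ 2 + 186 * n + 107                  ≤⟨ +-monoˡ-≤ 107 (+-monoʳ-≤ (81 * n ^ 2) (*-monoʳ-≤ 186 (n≤n² n))) ⟩
      81 * n ^ 2 + 186 * n ^ 2 + 107              <⟨ m<m+n _ {33 * n ^ 2 + 193} (m≤n⇒m≤o+n (33 * n ^ 2) (s≤s z≤n)) ⟩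
      81 * n ^ 2 + 186 * n ^ 2 + 107 + (33 * n ^ 2 + 193)  ≡⟨ collect (n ^ 2) ⟩
      300 * (1 + n ^ 2)                           ∎
      where
      expand : ∀ n → (1 + 2 * (3 * (1 + n)) + 3 * (1 + n)) * (1 + 2 * (3 * (1 + n)) + 3 * (1 + n)) + (1 + 2 * (3 * (1 + n)))
        ≡ 81 * (n * (n * 1)) + 186 * n + 107
      expand = solve-∀
      collect : ∀ x → 81 * x + 186 * x + 107 + (33 * x + 193) ≡ 300 * (1 + x)
      collect = solve-∀
      n≤n² : ∀ n → n ≤ n ^ 2
      n≤n² zero    = z≤n
      n≤n² (suc n) = m≤m*n (suc n) (suc n * 1)

-- The quadtree

isYes-true : ∀ {p} {P : Set p} (P? : Dec P) → P → ⌊ P? ⌋ ≡ true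
isYes-true P? p = trans (isYes≗does P?) (dec-true P? p)

module Tables {a c ℓ₁ ℓ₂} (X : DistanceSpace a c ℓ₁ ℓ₂) where
  open Machine X
  open DistanceSpace X using (Object; Distance; order; d; _≤?ᵈ_) renaming (_≟_ to _≟ᵒ_)
  private module O = DecTotalOrder order

  Pair : Set a
  Pair = Maybe Object × Maybe Object

  value : Pair → Maybe Distance
  value (s , t) = zipWith d s t

  -- The second condition refuses an object paired with itself, as happens on the diagonal and, in
  -- the middle of a deletion, when an object is listed twice. Blank challengers lose by the first
  -- condition, their value being +∞.
  better : Pair → Pair → Bool
  better e e′ = not (leq (value e) (value e′)) ∧ᵇ not ⌊ ≡-dec _≟ᵒ_ (proj₁ e′) (proj₂ e′) ⌋

  offer : Pair → Pair → Pair
  offer e e′ = if better e e′ then e′ else e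

  offers : Pair → Pair → Pair → Pair → Pair
  offers e₁ e₂ e₃ e₄ = offer (offer (offer e₁ e₂) e₃) e₄

  -- table l f i j is a closest pair between the blocks i and j of level l.
  table : ℕ → (ℕ → Maybe Object) → ℕ → ℕ → Pair
  table zero    f i j = offer (nothing , nothing) (f i , f j)
  table (suc l) f i j = offers
    (table l f (2 * i) (2 * j))       (table l f (2 * i) (1 + 2 * j))
    (table l f (1 + 2 * i) (2 * j)) (table l f (1 + 2 * i) (1 + 2 * j))

  leq-refl : ∀ x → leq x x ≡ true
  leq-refl nothing  = refl
  leq-refl (just x) = isYes-true (x ≤?ᵈ x) O.refl

  leq-trans : ∀ x y z → leq x y ≡ true → leq y z ≡ true → leq x z ≡ true
  leq-trans x        y        nothing  p q = refl
  leq-trans nothing  nothing  (just z) p q = q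
  leq-trans (just x) nothing  (just z) p ()
  leq-trans (just x) (just y) (just z) p q with x ≤?ᵈ y | y ≤?ᵈ z
  ... | yes x≤y | yes y≤z = isYes-true (x ≤?ᵈ z) (O.trans x≤y y≤z)

  leq-total : ∀ x y → leq x y ≡ false → leq y x ≡ true
  leq-total nothing  y        p = refl
  leq-total (just x) (just y) p with x ≤?ᵈ y | O.total x y
  ... | no x≰y | inj₁ x≤y = contradiction x≤y x≰y
  ... | no x≰y | inj₂ y≤x = isYes-true (y ≤?ᵈ x) y≤x

  leq-just : ∀ {x y} → leq (just x) (just y) ≡ true → x O.≤ y
  leq-just {x} {y} p with x ≤?ᵈ y
  ... | yes x≤y = x≤y

  data Valid (f : ℕ → Maybe Object) : Pair → Set a where
    blank : Valid f (nothing , nothing)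
    pair  : ∀ {s t i j} → f i ≡ just s → f j ≡ just t → s ≢ t → Valid f (just s , just t)

  offer-cases : ∀ e e′ → offer e e′ ≡ e ⊎ offer e e′ ≡ e′
  offer-cases e e′ with better e e′
  ... | true  = inj₂ refl
  ... | false = inj₁ refl

  offer-valid : ∀ {f e e′} → Valid f e → Valid f e′ → Valid f (offer e e′)
  offer-valid {f} {e} {e′} v v′ with offer-cases e e′
  ... | inj₁ eq = subst (Valid f) (sym eq) v
  ... | inj₂ eq = subst (Valid f) (sym eq) v′

  leaf-valid : ∀ f i j → Valid f (offer (nothing , nothing) (f i , f j))
  leaf-valid f i j with f i in fi | f j in fj
  ... | nothing | _       = blank
  ... | just s  | nothing = blank
  ... | just s  | just t  with s ≟ᵒ t
  ...   | yes _  = blank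
  ...   | no s≢t = pair fi fj s≢t

  table-valid : ∀ l f i j → Valid f (table l f i j)
  table-valid zero    f i j = leaf-valid f i j
  table-valid (suc l) f i j = offer-valid (offer-valid (offer-valid
    (table-valid l f _ _) (table-valid l f _ _)) (table-valid l f _ _)) (table-valid l f _ _)

  leq-offerˡ : ∀ e e′ → leq (value (offer e e′)) (value e) ≡ true
  leq-offerˡ e e′ with leq (value e) (value e′) in le | ⌊ ≡-dec _≟ᵒ_ (proj₁ e′) (proj₂ e′) ⌋
  ... | true  | _     = leq-refl (value e)
  ... | false | true  = leq-refl (value e)
  ... | false | false = leq-total (value e) (value e′) le

  -- A challenger made of two equal objects would be refused whatever its distance. Validity
  -- excludes this case.
  leq-offerʳ : ∀ {f} e {e′} → Valid f e′ → leq (value (offer e e′)) (value e′) ≡ true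
  leq-offerʳ e blank = refl
  leq-offerʳ e (pair {s} {t} _ _ s≢t) with leq (value e) (just (d s t)) in le | s ≟ᵒ t
  ... | _     | yes s≡t = contradiction s≡t s≢t
  ... | true  | no _    = le
  ... | false | no _    = leq-refl (just (d s t))

  module _ {f : ℕ → Maybe Object} (e₁ : Pair) {e₂ e₃ e₄ : Pair}
           (v₂ : Valid f e₂) (v₃ : Valid f e₃) (v₄ : Valid f e₄) where
    private
      Least : Pair → Set
      Least e = leq (value (offers e₁ e₂ e₃ e₄)) (value e) ≡ true

    leq-offers₄ : Least e₄
    leq-offers₄ = leq-offerʳ (offer (offer e₁ e₂) e₃) v₄

    leq-offers₃ : Least e₃
    leq-offers₃ = leq-trans (value (offers e₁ e₂ e₃ e₄)) (value (offer (offer e₁ e₂) e₃)) (value e₃)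
      (leq-offerˡ (offer (offer e₁ e₂) e₃) e₄) (leq-offerʳ (offer e₁ e₂) v₃)

    private
      leq-offers₁₂ : Least (offer e₁ e₂)
      leq-offers₁₂ = leq-trans (value (offers e₁ e₂ e₃ e₄)) (value (offer (offer e₁ e₂) e₃)) (value (offer e₁ e₂))
        (leq-offerˡ (offer (offer e₁ e₂) e₃) e₄) (leq-offerˡ (offer e₁ e₂) e₃)

    leq-offers₂ : Least e₂
    leq-offers₂ = leq-trans (value (offers e₁ e₂ e₃ e₄)) (value (offer e₁ e₂)) (value e₂)
      leq-offers₁₂ (leq-offerʳ e₁ v₂)

    leq-offers₁ : Least e₁
    leq-offers₁ = leq-trans (value (offers e₁ e₂ e₃ e₄)) (value (offer e₁ e₂)) (value e₁)
      leq-offers₁₂ (leq-offerˡ e₁ e₂)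

  -- By `halves`, the level-`l` blocks of `x` and `y` index one of the four children of their
  -- parents' entry, which is at most as large as each child.
  table-minimal : ∀ l f {x y u v} → f x ≡ just u → f y ≡ just v → u ≢ v →
    leq (value (table l f (ancestor l x) (ancestor l y))) (just (d u v)) ≡ true
  table-minimal zero f {x} {y} fx fy u≢v rewrite fx | fy =
    leq-offerʳ {f} (nothing , nothing) (pair fx fy u≢v)
  table-minimal (suc l) f {x} {y} {u} {v} fx fy u≢v =
    below (table-minimal l f fx fy u≢v) (halves (ancestor l x)) (halves (ancestor l y))
    where
    i j : ℕ
    i = ancestor l x / 2
    j = ancestor l y / 2
    t : ℕ → ℕ → Pair
    t = table l f
    e = table (suc l) f i j
    e₁ = t (2 * i) (2 * j)
    v₂ = table-valid l f (2 * i) (1 + 2 * j)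
    v₃ = table-valid l f (1 + 2 * i) (2 * j)
    v₄ = table-valid l f (1 + 2 * i) (1 + 2 * j)
    through : ∀ e′ → leq (value e) (value e′) ≡ true → leq (value e′) (just (d u v)) ≡ true →
      leq (value e) (just (d u v)) ≡ true
    through e′ = leq-trans (value e) (value e′) (just (d u v))
    below : ∀ {i′ j′} → leq (value (t i′ j′)) (just (d u v)) ≡ true →
      i′ ≡ 2 * i ⊎ i′ ≡ 1 + 2 * i → j′ ≡ 2 * j ⊎ j′ ≡ 1 + 2 * j →
      leq (value e) (just (d u v)) ≡ true
    below h (inj₁ refl) (inj₁ refl) = through e₁ (leq-offers₁ e₁ v₂ v₃ v₄) h
    below h (inj₁ refl) (inj₂ refl) = through (t (2 * i) (1 + 2 * j)) (leq-offers₂ e₁ v₂ v₃ v₄) h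
    below h (inj₂ refl) (inj₁ refl) = through (t (1 + 2 * i) (2 * j)) (leq-offers₃ e₁ v₂ v₃ v₄) h
    below h (inj₂ refl) (inj₂ refl) = through (t (1 + 2 * i) (1 + 2 * j)) (leq-offers₄ e₁ v₂ v₃ v₄) h

  offers-cong : ∀ {e₁ e₂ e₃ e₄ e₁′ e₂′ e₃′ e₄′} → e₁ ≡ e₁′ → e₂ ≡ e₂′ → e₃ ≡ e₃′ → e₄ ≡ e₄′ →
    offers e₁ e₂ e₃ e₄ ≡ offers e₁′ e₂′ e₃′ e₄′
  offers-cong refl refl refl refl = refl

  -- An entry depends only on the objects in its two blocks, and `p` lies in neither: a child equal
  -- to `ancestor l p` would have `ancestor (suc l) p` as its parent.
  table-cong : ∀ l {f g} p → (∀ x → x ≢ p → f x ≡ g x) → ∀ {i j} →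
    i ≢ ancestor l p → j ≢ ancestor l p → table l f i j ≡ table l g i j
  table-cong zero    p f≗g i≢ j≢ = cong₂ (λ s t → offer (nothing , nothing) (s , t)) (f≗g _ i≢) (f≗g _ j≢)
  table-cong (suc l) {f} {g} p f≗g {i} {j} i≢ j≢ = offers-cong
    (at (even i≢) (even j≢)) (at (even i≢) (odd j≢)) (at (odd i≢) (even j≢)) (at (odd i≢) (odd j≢))
    where
    at : ∀ {i j} → i ≢ ancestor l p → j ≢ ancestor l p → table l f i j ≡ table l g i j
    at = table-cong l p f≗g
    even : ∀ {i} → i ≢ ancestor (suc l) p → 2 * i ≢ ancestor l p
    even {i} i≢ eq = i≢ (trans (sym (half-even i)) (cong (_/ 2) eq))
    odd : ∀ {i} → i ≢ ancestor (suc l) p → 1 + 2 * i ≢ ancestor l p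
    odd {i} i≢ eq = i≢ (trans (sym (half-odd i)) (cong (_/ 2) eq))

  offer-nothingʳ : ∀ s → offer (nothing , nothing) (s , nothing) ≡ (nothing , nothing)
  offer-nothingʳ nothing  = refl
  offer-nothingʳ (just _) = refl

  -- The origin entry of level 0 pairs object 0 with itself, so the freshly cleared answer cells
  -- already hold it.
  offer-self : ∀ s → offer (nothing , nothing) (s , s) ≡ (nothing , nothing)
  offer-self nothing  = refl
  offer-self (just s) rewrite isYes-true (≡-dec _≟ᵒ_ (just s) (just s)) refl = refl

  -- This lets `Tabled` range over all levels and blocks: an entry that has not been reached yet is
  -- blank, as it should be, and a growing set finds it ready.
  table-blank : ∀ l {f N} → (∀ x → N ≤ x → f x ≡ nothing) → ∀ {i j} →
    width l N ≤ i ⊎ width l N ≤ j → table l f i j ≡ (nothing , nothing)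
  table-blank zero    {f} out {i} {j} (inj₁ N≤i) rewrite out i N≤i = refl
  table-blank zero    {f} out {i} {j} (inj₂ N≤j) rewrite out j N≤j = offer-nothingʳ (f i)
  table-blank (suc l) {f} {N} out {i} {j} h = offers-cong
    (at (beyond h even even)) (at (beyond h even odd)) (at (beyond h odd even)) (at (beyond h odd odd))
    where
    at : ∀ {i j} → width l N ≤ i ⊎ width l N ≤ j → table l f i j ≡ (nothing , nothing)
    at = table-blank l out
    even : ∀ {i} → width (suc l) N ≤ i → width l N ≤ 2 * i
    even = ≤-half
    odd : ∀ {i} → width (suc l) N ≤ i → width l N ≤ 1 + 2 * i
    odd h = m≤n⇒m≤1+n (≤-half h)
    beyond : ∀ {i j i′ j′} → width (suc l) N ≤ i ⊎ width (suc l) N ≤ j →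
      (width (suc l) N ≤ i → width l N ≤ i′) → (width (suc l) N ≤ j → width l N ≤ j′) →
      width l N ≤ i′ ⊎ width l N ≤ j′
    beyond (inj₁ h) g _ = inj₁ (g h)
    beyond (inj₂ h) _ g = inj₂ (g h)

-- Programs

-- While level l is processed for position p, scale is 2 ^ l (2 ^ (l - 1) inside
-- cross inner), span is width l count and block is ancestor l p.
count position scale span block counter : WordExpr
count    = word[ lit 0 ]
position = word[ lit 1 ]
scale    = word[ lit 2 ]
span     = word[ lit 3 ]
block    = word[ lit 4 ]
counter  = word[ lit 5 ]

cellᵉ : WordExpr → WordExpr → WordExpr
cellᵉ u v = (u ⊕ v) ⊗ (u ⊕ v) ⊕ u

codeᵉ : WordExpr → WordExpr → WordExpr
codeᵉ s i = s ⊗ (lit 1 ⊕ lit 2 ⊗ i)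

slotᵉ : WordExpr → WordExpr
slotᵉ i = cellᵉ (lit 0) (lit 2 ⊕ i)

Locationᵉ : Set
Locationᵉ = WordExpr × WordExpr

entryᵉ : Fin 2 → WordExpr → WordExpr → WordExpr → WordExpr
entryᵉ b s i j = cellᵉ (lit (toℕ b) ⊕ lit 2 ⊗ codeᵉ s i) (codeᵉ s j)

entriesᵉ : WordExpr → WordExpr → WordExpr → Locationᵉ
entriesᵉ s i j = entryᵉ 0F s i j , entryᵉ 1F s i j

slotsᵉ : WordExpr → WordExpr → Locationᵉ
slotsᵉ i j = slotᵉ i , slotᵉ j

resultᵉ : Locationᵉ
resultᵉ = lit 1 , lit 2

clear : Locationᵉ → Program
clear (x , y) = object[ x ]≔ blank ⨾ object[ y ]≔ blank

copy : Locationᵉ → Locationᵉ → Program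
copy (x , y) (u , v) = object[ x ]≔ object[ u ] ⨾ object[ y ]≔ object[ v ]

challenge : Locationᵉ → Locationᵉ → Program
challenge (x , y) (u , v) = cond
  (¬ᵗ (δ object[ x ] object[ y ] ≤ᵈ δ object[ u ] object[ v ]) ∧ ¬ᵗ (object[ u ] ≐ᵒ object[ v ]))
  (copy (x , y) (u , v)) skip

challenges : Locationᵉ → Locationᵉ → Locationᵉ → Locationᵉ → Program
challenges e e₂ e₃ e₄ = challenge e e₂ ⨾ challenge e e₃ ⨾ challenge e e₄

-- The entries (l , 0 , 0) are nonblank for arbitrarily large l, hence must not be
-- stored.  Cells 1 and 2 hold the one of the current level.
unlessOrigin : WordExpr → WordExpr → Program → Program
unlessOrigin i j p = cond (lit 1 ≤ʷ i ⊕ j) p skip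

leaf inner : WordExpr → WordExpr → Program
leaf i j = unlessOrigin i j (clear (entriesᵉ scale i j) ⨾ challenge (entriesᵉ scale i j) (slotsᵉ i j))
inner i j = unlessOrigin i j
  (copy e (entriesᵉ scale (lit 2 ⊗ i) (lit 2 ⊗ j)) ⨾
   challenges e (entriesᵉ scale (lit 2 ⊗ i) (lit 1 ⊕ lit 2 ⊗ j))
                (entriesᵉ scale (lit 1 ⊕ lit 2 ⊗ i) (lit 2 ⊗ j))
                (entriesᵉ scale (lit 1 ⊕ lit 2 ⊗ i) (lit 1 ⊕ lit 2 ⊗ j)))
  where
  e : Locationᵉ
  e = entriesᵉ (lit 2 ⊗ scale) i j

cross : (WordExpr → WordExpr → Program) → Program
cross visit = word[ lit 5 ]≔ lit 0 ⨾
  while (lit 1 ⊕ counter ≤ʷ span)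
    (visit block counter ⨾ visit counter block ⨾ word[ lit 5 ]≔ lit 1 ⊕ counter)

ascend : Program
ascend =
  -- Cells 1 and 2 hold the entry (l , 0 , 0), the first child of (l + 1 , 0 , 0). Its three
  -- siblings are stored, so three challenges lift the answer by one level.
  challenges resultᵉ (entriesᵉ scale (lit 0) (lit 1)) (entriesᵉ scale (lit 1) (lit 0))
                     (entriesᵉ scale (lit 1) (lit 1)) ⨾
  word[ lit 4 ]≔ block ⊘ lit 2 ⨾
  word[ lit 3 ]≔ (lit 1 ⊕ span) ⊘ lit 2 ⨾
  cross inner ⨾
  word[ lit 2 ]≔ lit 2 ⊗ scale

refresh : Program
refresh =
  word[ lit 2 ]≔ lit 1 ⨾
  word[ lit 3 ]≔ count ⨾
  word[ lit 4 ]≔ position ⨾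
  clear resultᵉ ⨾
  cross leaf ⨾
  while (lit 2 ≤ʷ span) ascend

reset : Program
reset = word[ lit 1 ]≔ lit 0 ⨾ word[ lit 2 ]≔ lit 0 ⨾ word[ lit 3 ]≔ lit 0 ⨾
        word[ lit 4 ]≔ lit 0 ⨾ word[ lit 5 ]≔ lit 0

-- The scan begins at position 0 because `reset` has cleared the register.
search : Program
search = while (¬ᵗ (object[ slotᵉ position ] ≐ᵒ object[ lit 0 ])) (word[ lit 1 ]≔ lit 1 ⊕ position)

quadtree : Algorithm
quadtree = record
  { insertion =
      word[ lit 1 ]≔ count ⨾
      object[ slotᵉ position ]≔ object[ lit 0 ] ⨾
      -- The count grows before the refresh, whose initial span must cover the new position.
      word[ lit 0 ]≔ lit 1 ⊕ count ⨾
      refresh ⨾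
      reset
  ; deletion =
      search ⨾
      object[ slotᵉ position ]≔ object[ slotᵉ (count ⊖ lit 1) ] ⨾
      -- A refresh repairs the effect of a change at one position only, so moving the last object
      -- and blanking its old place take one refresh each. In between, that object may be listed
      -- twice.
      refresh ⨾
      object[ slotᵉ (count ⊖ lit 1) ]≔ blank ⨾
      word[ lit 1 ]≔ count ⊖ lit 1 ⨾
      refresh ⨾
      -- The count drops only now: the second refresh still had to visit the entries of the vacated
      -- position in order to blank them.
      word[ lit 0 ]≔ count ⊖ lit 1 ⨾
      reset
  }

-- Memory updates and disjoint locations

module _ {a} {A : Set a} (f : ℕ → A) (i : ℕ) (v : A) where
  private
    ≡ᵇ-refl : ∀ i → (i ≡ᵇ i) ≡ true
    ≡ᵇ-refl i = Equivalence.to T-≡ (≡⇒≡ᵇ i i refl)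

  updated : (f [ i ↦ v ]) i ≡ v
  updated rewrite ≡ᵇ-refl i = refl

  untouched : ∀ {j} → j ≢ i → (f [ i ↦ v ]) j ≡ f j
  untouched {j} j≢i with i ≡ᵇ j in eq
  ... | false = refl
  ... | true  = contradiction (sym (≡ᵇ⇒≡ i j (Equivalence.from T-≡ eq))) j≢i

  updated-elim : ∀ {p} (P : ℕ → A → Set p) → P i v → (∀ j → P j (f j)) → ∀ j → P j ((f [ i ↦ v ]) j)
  updated-elim P new old j with i ≡ᵇ j in eq
  ... | false = old j
  ... | true  = subst (λ j → P j v) (≡ᵇ⇒≡ i j (Equivalence.from T-≡ eq)) new

≤ᵇ-true : ∀ {m n} → m ≤ n → (m ≤ᵇ n) ≡ true
≤ᵇ-true m≤n = Equivalence.to T-≡ (≤⇒≤ᵇ m≤n)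

≤ᵇ-false : ∀ {m n} → n < m → (m ≤ᵇ n) ≡ false
≤ᵇ-false {m} {n} n<m with m ≤ᵇ n in eq
... | false = refl
... | true  = contradiction (≤ᵇ⇒≤ m n (Equivalence.from T-≡ eq)) (<⇒≱ n<m)

Location : Set
Location = ℕ × ℕ

entries : ℕ → ℕ → ℕ → Location
entries l i j = entry 0F l i j , entry 1F l i j

result : Location
result = 1 , 2

record Apart (ℓ m : Location) : Set where
  constructor apart
  field
    u≢x : proj₁ m ≢ proj₁ ℓ
    u≢y : proj₁ m ≢ proj₂ ℓ
    v≢x : proj₂ m ≢ proj₁ ℓ
    v≢y : proj₂ m ≢ proj₂ ℓ

entries-apart : ∀ {l i j l′ i′ j′} → ¬ (l′ ≡ l × i′ ≡ i × j′ ≡ j) → Apart (entries l i j) (entries l′ i′ j′)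
entries-apart {l} {i} {j} {l′} {i′} {j′} different = apart (distinct 0F 0F) (distinct 0F 1F) (distinct 1F 0F) (distinct 1F 1F)
  where
  distinct : ∀ b b′ → entry b l′ i′ j′ ≢ entry b′ l i j
  distinct b b′ eq = different (proj₂ (entry-injective {b} {l′} {i′} {j′} {b′} {l} {i} {j} eq))

slots-apart : ∀ {l i j k k′} → Apart (entries l i j) (slot k , slot k′)
slots-apart {l} {i} {j} {k} {k′} = apart
  (slot≢entry {k} {0F} {l} {i} {j}) (slot≢entry {k} {1F} {l} {i} {j})
  (slot≢entry {k′} {0F} {l} {i} {j}) (slot≢entry {k′} {1F} {l} {i} {j})

result-apart : ∀ {u v} → 3 ≤ u → 3 ≤ v → Apart result (u , v)
result-apart 3≤u 3≤v = apart (far 3≤u 1) (far 3≤u 2) (far 3≤v 1) (far 3≤v 2)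
  where
  far : ∀ {u} → 3 ≤ u → ∀ c {c<3 : T (c <ᵇ 3)} → u ≢ c
  far 3≤u c {c<3} refl = <⇒≱ (<ᵇ⇒< c 3 c<3) 3≤u

-- Executions

module Execution {a c ℓ₁ ℓ₂} (X : DistanceSpace a c ℓ₁ ℓ₂) (N : ℕ) where
  open Machine X
  open State
  open Tables X
  open DistanceSpace X using (Object)

  Words Objects : _
  Words   = ℕ → ℕ
  Objects = ℕ → Maybe Object

  ⟨_,_⟩ : Words → Objects → State
  ⟨ w , o ⟩ = record { word = w ; object = o ; distance = λ _ → nothing }

  -- The factor 2 is due to `scale`, which is doubled once more after the last level `l` with
  -- `2 ^ l < N`.
  record Tame (w : Words) : Set where
    field
      small  : ∀ i → w i ≤ 2 * N
      unused : ∀ i → 6 ≤ i → w i ≡ 0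
  open Tame public

  Confined : Objects → Set a
  Confined o = ∀ i → o i ≡ nothing ⊎ Used N i

  Safe : State → Set (a ⊔ c)
  Safe σ = Tame (word σ) × Confined (object σ) × (∀ i → distance σ i ≡ nothing)

  Post : _
  Post = Words → Objects → Set a

  -- A total-correctness triple with a time bound. Safety concerns the whole trace because the space
  -- bound is required after every step.
  record Outcome (p : Program) (w : Words) (o : Objects) (t : ℕ) (Q : Post) : Set (a ⊔ c) where
    constructor outcome
    field
      {trace} : List State
      {w′}    : Words
      {o′}    : Objects
      run     : Run p ⟨ w , o ⟩ trace ⟨ w′ , o′ ⟩
      time    : length trace ≤ t
      safe    : All Safe trace
      post    : Q w′ o′

  weaken : ∀ {p w o t t′} {Q R : Post} → t ≤ t′ → (∀ {w′ o′} → Q w′ o′ → R w′ o′) →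
    Outcome p w o t Q → Outcome p w o t′ R
  weaken t≤t′ f (outcome r h s q) = outcome r (≤-trans h t≤t′) s (f q)

  infixl 1 _⨾ᵒ_
  _⨾ᵒ_ : ∀ {p q w o t t′} {Q R : Post} → Outcome p w o t Q →
    (∀ {w′ o′} → Q w′ o′ → Outcome q w′ o′ t′ R) → Outcome (p ⨾ q) w o (t + t′) R
  outcome {trace = τ} r h s q ⨾ᵒ f with outcome r′ h′ s′ q′ ← f q = outcome (seq r r′)
    (≤-trans (≤-reflexive (length-++ τ)) (+-mono-≤ h h′)) (++⁺ s s′) q′

  module _ {w : Words} {o : Objects} (tame : Tame w) (confined : Confined o) where
    assigned : ∀ i {x} → i < 6 → x ≤ 2 * N → Tame (w [ i ↦ x ])
    assigned i {x} i<6 x≤ = record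
      { small  = updated-elim w i x (λ _ y → y ≤ 2 * N) x≤ (small tame)
      ; unused = updated-elim w i x (λ j y → 6 ≤ j → y ≡ 0) (λ 6≤i → contradiction 6≤i (<⇒≱ i<6)) (unused tame)
      }

    assign : ∀ i {i<6 : T (i <ᵇ 6)} e {Q : Post} → ⟦ e ⟧ʷ ⟨ w , o ⟩ ≤ 2 * N →
      (Tame (w [ i ↦ ⟦ e ⟧ʷ ⟨ w , o ⟩ ]) → Q (w [ i ↦ ⟦ e ⟧ʷ ⟨ w , o ⟩ ]) o) →
      Outcome (word[ lit i ]≔ e) w o 1 Q
    assign i {i<6} e e≤ q = outcome word≔ ≤-refl ((tame′ , confined , λ _ → refl) ∷ []) (q tame′)
      where tame′ = assigned i (<ᵇ⇒< i 6 i<6) e≤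

    assign⨾ : ∀ i {i<6 : T (i <ᵇ 6)} e {q t} {Q : Post} → ⟦ e ⟧ʷ ⟨ w , o ⟩ ≤ 2 * N →
      (Tame (w [ i ↦ ⟦ e ⟧ʷ ⟨ w , o ⟩ ]) → Outcome q (w [ i ↦ ⟦ e ⟧ʷ ⟨ w , o ⟩ ]) o t Q) →
      Outcome (word[ lit i ]≔ e ⨾ q) w o (suc t) Q
    assign⨾ i {i<6} e e≤ f with outcome r h s q ← f (assigned i (<ᵇ⇒< i 6 i<6) e≤) = outcome
      (seq word≔ r) (s≤s h) ((assigned i (<ᵇ⇒< i 6 i<6) e≤ , confined , λ _ → refl) ∷ s) q

    stored : ∀ {i x} → Used N i → Confined (o [ i ↦ x ])
    stored {i} {x} used = updated-elim o i x (λ j y → y ≡ nothing ⊎ Used N j) (inj₂ used) confined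

    private
      run-store : ∀ {e f σ i x} → ⟦ e ⟧ʷ σ ≡ i → ⟦ f ⟧ᵒ σ ≡ x →
        Run (object[ e ]≔ f) σ (setObject i x σ ∷ []) (setObject i x σ)
      run-store refl refl = object≔

    store : ∀ {e f i x} {Q : Post} → ⟦ e ⟧ʷ ⟨ w , o ⟩ ≡ i → ⟦ f ⟧ᵒ ⟨ w , o ⟩ ≡ x → Used N i →
      (Confined (o [ i ↦ x ]) → Q w (o [ i ↦ x ])) → Outcome (object[ e ]≔ f) w o 1 Q
    store e≡ f≡ used q = outcome (run-store e≡ f≡) ≤-refl
      ((tame , stored used , λ _ → refl) ∷ []) (q (stored used))

    store⨾ : ∀ {e f i x q t} {Q : Post} → ⟦ e ⟧ʷ ⟨ w , o ⟩ ≡ i → ⟦ f ⟧ᵒ ⟨ w , o ⟩ ≡ x → Used N i →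
      (Confined (o [ i ↦ x ]) → Outcome q w (o [ i ↦ x ]) t Q) → Outcome (object[ e ]≔ f ⨾ q) w o (suc t) Q
    store⨾ e≡ f≡ used f with outcome r h s q ← f (stored used) = outcome
      (seq (run-store e≡ f≡) r) (s≤s h) ((tame , stored used , λ _ → refl) ∷ s) q

    skipped : ∀ {Q : Post} → Q w o → Outcome skip w o 1 Q
    skipped q = outcome skip ≤-refl ((tame , confined , λ _ → refl) ∷ []) q

    branch : ∀ {b p q t} {Q : Post} → (⟦ b ⟧ᵗ ⟨ w , o ⟩ ≡ true → Outcome p w o t Q) →
      (⟦ b ⟧ᵗ ⟨ w , o ⟩ ≡ false → Outcome q w o t Q) → Outcome (cond b p q) w o (suc t) Q
    branch {b} f g with ⟦ b ⟧ᵗ ⟨ w , o ⟩ in eq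
    ... | true  with outcome r h s q ← f refl = outcome (cond-true eq r) (s≤s h) ((tame , confined , λ _ → refl) ∷ s) q
    ... | false with outcome r h s q ← g refl = outcome (cond-false eq r) (s≤s h) ((tame , confined , λ _ → refl) ∷ s) q

    while-exit : ∀ {b p} {Q : Post} → ⟦ b ⟧ᵗ ⟨ w , o ⟩ ≡ false → Q w o → Outcome (while b p) w o 1 Q
    while-exit b≡ q = outcome (while-false b≡) ≤-refl ((tame , confined , λ _ → refl) ∷ []) q

    while-step : ∀ {b p t t′} {Q R : Post} → ⟦ b ⟧ᵗ ⟨ w , o ⟩ ≡ true → Outcome p w o t Q →
      (∀ {w′ o′} → Q w′ o′ → Outcome (while b p) w′ o′ t′ R) → Outcome (while b p) w o (suc (t + t′)) R
    while-step b≡ (outcome {trace = τ} r h s q) f with outcome r′ h′ s′ q′ ← f q = outcome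
      (while-true b≡ r r′) (s≤s (≤-trans (≤-reflexive (length-++ τ)) (+-mono-≤ h h′)))
      ((tame , confined , λ _ → refl) ∷ ++⁺ s s′) q′

  -- The rule for counting loops. Recursion is on the number `k` of remaining rounds; a round costs
  -- its body and one test, and the final 1 is the failing test.
  for : ∀ {b p t m} (J : ℕ → Post) →
    (∀ {j w o} → J j w o → Tame w × Confined o) →
    (∀ {j w o} → J j w o → ⟦ b ⟧ᵗ ⟨ w , o ⟩ ≡ (suc j ≤ᵇ m)) →
    (∀ {j w o} → j < m → J j w o → Outcome p w o t (J (suc j))) →
    ∀ k {j w o} → k + j ≡ m → J j w o → Outcome (while b p) w o (k * suc t + 1) (J m)
  for {m = m} J safe test step zero refl J₀ with tame , confined ← safe J₀ =
    while-exit tame confined (trans (test J₀) (≤ᵇ-false {suc m} ≤-refl)) J₀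
  for {t = t} {m} J safe test step (suc k) {j} k+j≡m J₀ with tame , confined ← safe J₀ =
    weaken (≤-reflexive (cong suc (sym (+-assoc t (k * suc t) 1)))) (λ q → q)
      (while-step tame confined (trans (test J₀) (≤ᵇ-true j<m)) (step j<m J₀)
        (for J safe test step k (trans (+-suc k j) k+j≡m)))
    where
    j<m : j < m
    j<m = ≤-trans (s≤s (m≤n+m j k)) (≤-reflexive k+j≡m)

  -- Reading and overwriting pairs of cells

  read : Objects → Location → Pair
  read o (x , y) = o x , o y

  infix 4 _⊢_⇓_ _⊢_⇓ˡ_
  -- The value may not depend on the object bank, so that it survives writes to it.
  record _⊢_⇓_ (w : Words) (e : WordExpr) (x : ℕ) : Set a where
    constructor evaluated
    field value-at : ∀ o → ⟦ e ⟧ʷ ⟨ w , o ⟩ ≡ x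
  open _⊢_⇓_ public

  record _⊢_⇓ˡ_ (w : Words) (e : Locationᵉ) (ℓ : Location) : Set a where
    constructor _,_
    field
      first⇓  : w ⊢ proj₁ e ⇓ proj₁ ℓ
      second⇓ : w ⊢ proj₂ e ⇓ proj₂ ℓ
  open _⊢_⇓ˡ_

  record Patch (ℓ : Location) (e : Pair) (o o′ : Objects) : Set a where
    constructor patch
    field
      confined′ : Confined o′
      new       : read o′ ℓ ≡ e
      old       : ∀ {i} → i ≢ proj₁ ℓ → i ≢ proj₂ ℓ → o′ i ≡ o i
  open Patch public

  Patched : Location → Pair → Words → Objects → Post
  Patched ℓ e w o w′ o′ = w′ ≡ w × Patch ℓ e o o′

  read-old : ∀ {ℓ m e o o′} → Patch ℓ e o o′ → Apart ℓ m → read o′ m ≡ read o m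
  read-old π (apart u≢x u≢y v≢x v≢y) = cong₂ _,_ (old π u≢x u≢y) (old π v≢x v≢y)

  patch-trans : ∀ {ℓ e e′ o o₁ o₂} → Patch ℓ e o o₁ → Patch ℓ e′ o₁ o₂ → Patch ℓ e′ o o₂
  patch-trans π π′ = patch (confined′ π′) (new π′) (λ x y → trans (old π′ x y) (old π x y))

  record Target (ℓ : Location) : Set where
    constructor target
    field
      x-used : Used N (proj₁ ℓ)
      y-used : Used N (proj₂ ℓ)
      x≢y    : proj₁ ℓ ≢ proj₂ ℓ

  module _ {w : Words} {e ℓ} (tame : Tame w) (e⇓ : w ⊢ e ⇓ˡ ℓ) (t : Target ℓ) where
    open Target t
    private
      x = proj₁ ℓ
      y = proj₂ ℓ

      written : ∀ {o s t} → Confined ((o [ x ↦ s ]) [ y ↦ t ]) → Patch ℓ (s , t) o ((o [ x ↦ s ]) [ y ↦ t ])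
      written {o} {s} {t} confined = patch confined
        (cong₂ _,_ (trans (untouched (o [ x ↦ s ]) y t x≢y) (updated o x s)) (updated (o [ x ↦ s ]) y t))
        (λ ≢x ≢y → trans (untouched (o [ x ↦ s ]) y t ≢y) (untouched o x s ≢x))

    module _ {o : Objects} (confined : Confined o) where
      clear-outcome : Outcome (clear e) w o 2 (Patched ℓ (nothing , nothing) w o)
      clear-outcome = store⨾ tame confined (value-at (first⇓ e⇓) o) refl x-used λ confined₁ →
        store tame confined₁ (value-at (second⇓ e⇓) _) refl y-used λ confined₂ → refl , written confined₂

      module _ {e′ m} (e′⇓ : w ⊢ e′ ⇓ˡ m) (m# : Apart ℓ m) where
        open Apart m#

        copy-outcome : Outcome (copy e e′) w o 2 (Patched ℓ (read o m) w o)
        copy-outcome = store⨾ tame confined (value-at (first⇓ e⇓) o) (cong o (value-at (first⇓ e′⇓) o)) x-used λ confined₁ →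
          store tame confined₁ (value-at (second⇓ e⇓) _)
            -- The second source is read after the first target has been overwritten, so the two
            -- must be different cells.
            (trans (cong (o [ x ↦ _ ]) (value-at (second⇓ e′⇓) _)) (untouched o x _ v≢x)) y-used λ confined₂ →
          refl , written confined₂

        challenge-outcome : Outcome (challenge e e′) w o 3 (Patched ℓ (offer (read o ℓ) (read o m)) w o)
        challenge-outcome = branch tame confined
          (λ b → weaken ≤-refl (λ (w≡ , π) → w≡ , subst (λ e → Patch ℓ e o _) (sym (won (trans (sym test) b))) π)
                   copy-outcome)
          (λ b → weaken (n≤1+n 1) (λ q → q) (skipped tame confined
                   (refl , patch confined (sym (lost (trans (sym test) b))) (λ _ _ → refl))))
          where
          test : ⟦ ¬ᵗ (δ object[ proj₁ e ] object[ proj₂ e ] ≤ᵈ δ object[ proj₁ e′ ] object[ proj₂ e′ ])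
                 ∧ ¬ᵗ (object[ proj₁ e′ ] ≐ᵒ object[ proj₂ e′ ]) ⟧ᵗ ⟨ w , o ⟩ ≡ better (read o ℓ) (read o m)
          test rewrite value-at (first⇓ e⇓) o | value-at (second⇓ e⇓) o
                     | value-at (first⇓ e′⇓) o | value-at (second⇓ e′⇓) o = refl
          won : better (read o ℓ) (read o m) ≡ true → offer (read o ℓ) (read o m) ≡ read o m
          won b rewrite b = refl
          lost : better (read o ℓ) (read o m) ≡ false → offer (read o ℓ) (read o m) ≡ read o ℓ
          lost b rewrite b = refl

    challenge-after : ∀ {e₀ o o′ e′ m} → Patch ℓ e₀ o o′ → w ⊢ e′ ⇓ˡ m → Apart ℓ m →
      Outcome (challenge e e′) w o′ 3 (Patched ℓ (offer e₀ (read o m)) w o)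
    challenge-after {o = o} π e′⇓ m# = weaken ≤-refl
      (λ (w≡ , π′) → w≡ , patch-trans π
        (subst₂ (λ e e′ → Patch ℓ (offer e e′) _ _) (new π) (read-old π m#) π′))
      (challenge-outcome (confined′ π) e′⇓ m#)

    challenges-after : ∀ {e₁ o o′ e₂ e₃ e₄ m₂ m₃ m₄} → Patch ℓ e₁ o o′ →
      w ⊢ e₂ ⇓ˡ m₂ → Apart ℓ m₂ → w ⊢ e₃ ⇓ˡ m₃ → Apart ℓ m₃ → w ⊢ e₄ ⇓ˡ m₄ → Apart ℓ m₄ →
      Outcome (challenges e e₂ e₃ e₄) w o′ 9
        (Patched ℓ (offers e₁ (read o m₂) (read o m₃) (read o m₄)) w o)
    challenges-after π e₂⇓ m₂# e₃⇓ m₃# e₄⇓ m₄# =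
      challenge-after π e₂⇓ m₂# ⨾ᵒ λ { (refl , π₂) →
      challenge-after π₂ e₃⇓ m₃# ⨾ᵒ λ { (refl , π₃) →
      challenge-after π₃ e₄⇓ m₄# } }

-- A region is a set of entries, indexed by level and two blocks, that may be out of date.
Region : Set₁
Region = ℕ → ℕ → ℕ → Set

infixl 5 _∖_
_∖_ : Region → ℕ × ℕ × ℕ → Region
(D ∖ (l , i , j)) l′ i′ j′ = D l′ i′ j′ × ¬ (l′ ≡ l × i′ ≡ i × j′ ≡ j)

width≤1 : ∀ {l l′ N} → l ≤′ l′ → width l N ≤ 1 → width l′ N ≤ 1
width≤1 ≤′-refl       h = h
width≤1 (≤′-step l≤l′) h = /-monoˡ-≤ 2 (s≤s (width≤1 l≤l′ h))

-- Refreshing the entries of one position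

-- `2 * pred m′ < m` is what is kept of `m′` being half of `m`, rounded up. The strict decrease lets
-- the climb terminate.
climb-< : ∀ {m} m′ → 2 ≤ m → 2 * pred m′ < m → m′ < m
climb-< zero          2≤m _    = <⇒≤ 2≤m
climb-< (suc zero)    2≤m _    = 2≤m
climb-< (suc (suc y)) _   2y<m = ≤-trans
  (s≤s (s≤s (≤-trans (s≤s (m≤m+n y (y + 0))) (≤-reflexive (sym (+-suc y (y + 0))))))) 2y<m

-- A level of width m costs 26 m + O(1); as the widths halve, 164 (m - 1) pays for
-- all levels above one of width m.
climb-time : ∀ {m} m′ → 2 ≤ m → 0 < m′ → 2 * pred m′ < m →
  suc (9 + suc (suc (suc (m′ * 26 + 1) + 1)) + (1 + 164 * pred m′)) ≤ 1 + 164 * pred m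
climb-time {suc zero} _ (s≤s ()) _ _
climb-time {suc (suc x)} (suc y) _ _ 2y<m = begin
  suc (9 + suc (suc (suc (suc y * 26 + 1) + 1)) + (1 + 164 * y))  ≡⟨ collect y ⟩
  -- 26 for the new level and 164 for those above it make 190, that is 95 for each unit of `2 * y`.
  -- The remaining `69 = 164 - 95` per unit of `suc x` absorb the fixed cost 42.
  42 + 95 * (2 * y)          ≤⟨ +-monoʳ-≤ 42 (*-monoʳ-≤ 95 (≤-pred 2y<m)) ⟩
  42 + 95 * suc x            ≤⟨ +-monoˡ-≤ (95 * suc x) (≤-trans (m≤m+n 42 27) (m≤m*n 69 (suc x))) ⟩
  69 * suc x + 95 * suc x    ≡⟨ *-distribʳ-+ (suc x) 69 95 ⟨
  164 * suc x                ≤⟨ n≤1+n (164 * suc x) ⟩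
  1 + 164 * suc x            ∎
  where
  open ≤-Reasoning
  collect : ∀ y → suc (9 + suc (suc (suc (suc y * 26 + 1) + 1)) + (1 + 164 * y)) ≡ 42 + 95 * (2 * y)
  collect = solve-∀

refresh-time : ∀ {N} → 0 < N → 5 + (suc (N * 26 + 1) + (1 + 164 * pred N)) ≤ 200 * N
refresh-time {suc x} _ = ≤-trans (m≤m+n _ (166 + 10 * x)) (≤-reflexive (collect x))
  where
  collect : ∀ x → 5 + (suc (suc x * 26 + 1) + (1 + 164 * x)) + (166 + 10 * x) ≡ 200 * suc x
  collect = solve-∀

module Refreshing {a c ℓ₁ ℓ₂} (X : DistanceSpace a c ℓ₁ ℓ₂) (N : ℕ) where
  open Machine X
  open Tables X
  open Execution X N
  open DistanceSpace X using (Object)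

  entries-target : ∀ l {i j} → i < width l N → j < width l N → 1 ≤ i + j → Target (entries l i j)
  entries-target l {i} {j} i< j< h = target (entered 0F l i< j< h) (entered 1F l i< j< h)
    λ eq → case (proj₁ (entry-injective {0F} {l} {i} {j} {1F} {l} {i} {j} eq))
    where
    case : 0F ≢ 1F
    case ()

  result-target : Target result
  result-target = target (reserved (s≤s (s≤s z≤n))) (reserved (s≤s (s≤s (s≤s z≤n)))) λ ()

  opaque
    unfolding slot entry

    entries⇓ : ∀ {w s i j i′ j′} l → w ⊢ s ⇓ 2 ^ l → w ⊢ i ⇓ i′ → w ⊢ j ⇓ j′ → w ⊢ entriesᵉ s i j ⇓ˡ entries l i′ j′
    entries⇓ {w} {s} {i} {j} {i′} {j′} l s⇓ i⇓ j⇓ = at 0F , at 1F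
      where
      at : ∀ b → w ⊢ entryᵉ b s i j ⇓ entry b l i′ j′
      value-at (at b) o rewrite value-at s⇓ o | value-at i⇓ o | value-at j⇓ o = refl

    slot⇓ : ∀ {w e i} → w ⊢ e ⇓ i → w ⊢ slotᵉ e ⇓ slot i
    value-at (slot⇓ e⇓) o rewrite value-at e⇓ o = refl

  literal : ∀ {w n} → w ⊢ lit n ⇓ n
  value-at literal o = refl

  register : ∀ {w i} → w ⊢ word[ lit i ] ⇓ w i
  value-at register o = refl

  register≡ : ∀ {w i x} → w i ≡ x → w ⊢ word[ lit i ] ⇓ x
  value-at (register≡ eq) o = eq

  twice : ∀ {w e x} → w ⊢ e ⇓ x → w ⊢ lit 2 ⊗ e ⇓ 2 * x
  value-at (twice e⇓) o = cong (2 *_) (value-at e⇓ o)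

  suc-twice : ∀ {w e x} → w ⊢ e ⇓ x → w ⊢ lit 1 ⊕ lit 2 ⊗ e ⇓ 1 + 2 * x
  value-at (suc-twice e⇓) o = cong suc (value-at (twice e⇓) o)

  Tabled : (ℕ → Maybe Object) → Objects → Set a
  Tabled f o = ∀ l i j → 1 ≤ i + j → read o (entries l i j) ≡ table l f i j

  module _ (f : ℕ → Maybe Object) where
    -- `f` is already the new listing, whereas entries in `D` may still reflect the old one. Origin
    -- entries are exempt; the one of the current level is tracked by `r`.
    record Progress (D : Region) (r : Pair) (o : Objects) : Set a where
      field
        confined : Confined o
        listed   : ∀ i → o (slot i) ≡ f i
        fresh    : ∀ l i j → 1 ≤ i + j → read o (entries l i j) ≡ table l f i j ⊎ D l i j
        answer   : read o result ≡ r
    open Progress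

    progress-⊆ : ∀ {D D′ r o} → (∀ l i j → 1 ≤ i + j → D l i j → D′ l i j) → Progress D r o → Progress D′ r o
    progress-⊆ D⊆D′ P = record
      { confined = confined P ; listed = listed P ; answer = answer P
      ; fresh = λ l i j h → map₂ (D⊆D′ l i j h) (fresh P l i j h) }

    progress-answer : ∀ {D r r′ o o′} → Progress D r o → Patch result r′ o o′ → Progress D r′ o′
    progress-answer P π = record
      { confined = confined′ π
      ; listed   = λ i → trans (old π (Apart.u≢x (result-apart (3≤slot i) (3≤slot i)))
                                     (Apart.u≢y (result-apart (3≤slot i) (3≤slot i)))) (listed P i)
      ; fresh    = λ l i j h → subst (λ e → e ≡ _ ⊎ _)
                     (sym (read-old π (result-apart (3≤entry 0F l i j) (3≤entry 1F l i j)))) (fresh P l i j h)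
      ; answer   = new π }

    progress-entry : ∀ {D r o o′} l i j → Progress D r o → Patch (entries l i j) (table l f i j) o o′ →
      Progress (D ∖ (l , i , j)) r o′
    progress-entry {D} {o = o} {o′} l i j P π = record
      { confined = confined′ π
      ; listed   = λ k → trans (old π (slot≢entry {k} {0F} {l} {i} {j}) (slot≢entry {k} {1F} {l} {i} {j})) (listed P k)
      ; fresh    = fresh′
      ; answer   = trans (read-old π
                     (apart (≢-sym (low 0F 1)) (≢-sym (low 1F 1)) (≢-sym (low 0F 2)) (≢-sym (low 1F 2)))) (answer P) }
      where
      low : ∀ b c {c<3 : T (c <ᵇ 3)} → entry b l i j ≢ c
      low b c {c<3} eq = <⇒≱ (<ᵇ⇒< c 3 c<3) (subst (3 ≤_) eq (3≤entry b l i j))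
      fresh′ : ∀ l′ i′ j′ → 1 ≤ i′ + j′ → read o′ (entries l′ i′ j′) ≡ table l′ f i′ j′ ⊎ (D ∖ (l , i , j)) l′ i′ j′
      fresh′ l′ i′ j′ h with (l′ ≟ l) ×-dec (i′ ≟ i) ×-dec (j′ ≟ j)
      ... | yes (refl , refl , refl) = inj₁ (new π)
      ... | no other with fresh P l′ i′ j′ h
      ...   | inj₁ eq = inj₁ (trans (read-old π (entries-apart other)) eq)
      ...   | inj₂ D∋ = inj₂ (D∋ , other)

    -- The region must lie at level `l` or above, so that the children one level below are up to
    -- date. The 12 steps are the origin test, a copy of 2 steps and three challenges of 3; two
    -- visits, the counter and the loop test then give 26 per round.
    Updates : ℕ → ℕ → (WordExpr → WordExpr → Program) → Set _
    Updates l s visit = ∀ {D r w o} a b → Tame w → w 2 ≡ s → w a < width l N → w b < width l N →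
      (∀ {l′ i j} → D l′ i j → l ≤ l′) → Progress D r o →
      Outcome (visit word[ lit a ] word[ lit b ]) w o 12
        λ w′ o′ → w′ ≡ w × Progress (D ∖ (l , w a , w b)) r o′

    unless-origin : ∀ {D r w o p} l a b → Tame w → Progress D r o →
      (1 ≤ w a + w b → Outcome p w o 11 (Patched (entries l (w a) (w b)) (table l f (w a) (w b)) w o)) →
      Outcome (unlessOrigin word[ lit a ] word[ lit b ] p) w o 12
        λ w′ o′ → w′ ≡ w × Progress (D ∖ (l , w a , w b)) r o′
    unless-origin {w = w} l a b tame P body = branch tame (confined P)
      (λ t → weaken ≤-refl (λ (w≡ , π) → w≡ , progress-entry l (w a) (w b) P π)
               (body (≤ᵇ⇒≤ 1 _ (Equivalence.from T-≡ t))))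
      -- What is skipped here is an origin entry, about which `Progress` claims nothing.
      (λ t → weaken (m≤m+n 1 10) (λ q → q) (skipped tame (confined P) (refl , progress-⊆
               (λ { l′ i j h D∋ → D∋ , λ { (_ , refl , refl) → contradiction (trans (sym (≤ᵇ-true h)) t) λ () } }) P)))

    leaf-updates : Updates 0 1 leaf
    leaf-updates {w = w} {o = o} a b tame s≡ a< b< _ P = unless-origin 0 a b tame P λ h →
      let e⇓ = entries⇓ 0 (register≡ s≡) register register
          t  = entries-target 0 a< b< h
      in weaken (m≤m+n 5 6) (λ (w≡ , π) → w≡ , subst (λ e → Patch (entries 0 (w a) (w b)) (offer (nothing , nothing) e) o _)
           (cong₂ _,_ (listed P (w a)) (listed P (w b))) π)
         (clear-outcome tame e⇓ t (confined P) ⨾ᵒ λ { (refl , π) →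
          challenge-after tame e⇓ t π (slot⇓ register , slot⇓ register) slots-apart })

    inner-updates : ∀ l → Updates (suc l) (2 ^ l) inner
    inner-updates l {D} {w = w} {o = o} a b tame s≡ a< b< above P = unless-origin (suc l) a b tame P λ h →
      let e⇓ = entries⇓ (suc l) (twice (register≡ s≡)) register register
          t  = entries-target (suc l) a< b< h
          i₀≤ = m≤m+n (w a) (w a + 0)
          j₀≤ = m≤m+n (w b) (w b + 0)
      in weaken ≤-refl (λ (w≡ , π) → w≡ , subst (λ e → Patch (entries (suc l) (w a) (w b)) e o _)
           -- A nonzero index stays nonzero when doubled, so none of the four children is an origin
           -- entry, and all are stored.
           (offers-cong (child (≤-trans h (+-mono-≤ i₀≤ j₀≤)))
                        (child (≤-trans h (+-mono-≤ i₀≤ (m≤n⇒m≤1+n j₀≤))))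
                        (child (≤-trans h (+-mono-≤ (m≤n⇒m≤1+n i₀≤) j₀≤)))
                        (child (≤-trans h (+-mono-≤ (m≤n⇒m≤1+n i₀≤) (m≤n⇒m≤1+n j₀≤))))) π)
         (copy-outcome tame e⇓ t (confined P) (children (twice register) (twice register)) lower ⨾ᵒ λ { (refl , π) →
          challenges-after tame e⇓ t π
            (children (twice register) (suc-twice register)) lower
            (children (suc-twice register) (twice register)) lower
            (children (suc-twice register) (suc-twice register)) lower })
      where
      child : ∀ {i j} → 1 ≤ i + j → read o (entries l i j) ≡ table l f i j
      child {i} {j} h with fresh P l i j h
      ... | inj₁ eq = eq
      ... | inj₂ D∋ = contradiction (above D∋) 1+n≰n
      children : ∀ {i j i′ j′} → w ⊢ i ⇓ i′ → w ⊢ j ⇓ j′ → w ⊢ entriesᵉ scale i j ⇓ˡ entries l i′ j′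
      children = entries⇓ l (register≡ s≡)
      lower : ∀ {i j i′ j′} → Apart (entries (suc l) i j) (entries l i′ j′)
      lower = entries-apart λ (l≡ , _) → <⇒≢ ≤-refl l≡

    record Solved (o : Objects) : Set a where
      field
        confined : Confined o
        listed   : ∀ i → o (slot i) ≡ f i
        tabled   : Tabled f o
        level    : ℕ
        narrow   : width level N ≤ 1
        answer   : read o result ≡ table level f 0 0

    record Refreshed (w : Words) (o : Objects) : Set a where
      field
        count≡ : w 0 ≡ N
        tame   : Tame w
        solved : Solved o

    module _ (p : ℕ) (p<N : p < N) where
      -- The row and the column end at the width: beyond it entries are blank both before and after
      -- the change.
      data Crossing (k l : ℕ) : ℕ → ℕ → Set where
        row    : ∀ {j} → k ≤ j → j < width l N → Crossing k l (ancestor l p) j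
        column : ∀ {i} → k ≤ i → i < width l N → Crossing k l i (ancestor l p)

      Above : ℕ → Region
      Above l l′ i j = l < l′ × Crossing 0 l′ i j

      -- What may be out of date when level l is being processed and the row and
      -- the column of p have been rewritten up to k.
      Stale : ℕ → ℕ → Region
      Stale l k l′ i j = Above l l′ i j ⊎ (l′ ≡ l × Crossing k l′ i j)

      crossing-inside : ∀ {k l i j} → Crossing k l i j → i < width l N × j < width l N
      crossing-inside {l = l} (row _ j<)    = ancestor<width l p<N , j<
      crossing-inside {l = l} (column _ i<) = i< , ancestor<width l p<N

      stale-step : ∀ {l k} l′ i j → 1 ≤ i + j →
        (Stale l k ∖ (l , ancestor l p , k) ∖ (l , k , ancestor l p)) l′ i j → Stale l (suc k) l′ i j
      stale-step l′ i j _ ((inj₁ above , _) , _) = inj₁ above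
      stale-step l′ i j _ ((inj₂ (refl , row k≤j j<) , ≢₁) , ≢₂) =
        inj₂ (refl , row (≤∧≢⇒< k≤j λ { refl → ≢₁ (refl , refl , refl) }) j<)
      stale-step l′ i j _ ((inj₂ (refl , column k≤i i<) , ≢₁) , ≢₂) =
        inj₂ (refl , column (≤∧≢⇒< k≤i λ { refl → ≢₂ (refl , refl , refl) }) i<)

      stale-end : ∀ {l} l′ i j → 1 ≤ i + j → Stale l (width l N) l′ i j → Above l l′ i j
      stale-end l′ i j _ (inj₁ above) = above
      stale-end l′ i j _ (inj₂ (refl , row w≤ <w)) = contradiction w≤ (<⇒≱ <w)
      stale-end l′ i j _ (inj₂ (refl , column w≤ <w)) = contradiction w≤ (<⇒≱ <w)

      above-next : ∀ {l} l′ i j → 1 ≤ i + j → Above l l′ i j → Stale (suc l) 0 l′ i j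
      above-next l′ i j _ (l<l′ , cross) with m≤n⇒m<n∨m≡n l<l′
      ... | inj₁ sl<l′ = inj₁ (sl<l′ , cross)
      ... | inj₂ refl  = inj₂ (refl , cross)

      stale-least : ∀ {l k l′ i j} → Stale l k l′ i j → l ≤ l′
      stale-least (inj₁ (l<l′ , _)) = <⇒≤ l<l′
      stale-least (inj₂ (refl , _)) = ≤-refl

      Agree : Words → Words → Set
      Agree w w′ = ∀ i {i<5 : T (i <ᵇ 5)} → w′ i ≡ w i

      cross-outcome : ∀ visit {r w o} l s → Updates l s visit → Tame w → w 2 ≡ s →
        w 3 ≡ width l N → w 4 ≡ ancestor l p → Progress (Stale l 0) r o →
        Outcome (cross visit) w o (suc (width l N * 26 + 1))
          λ w′ o′ → Agree w w′ × Tame w′ × Progress (Above l) r o′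
      cross-outcome visit {r} {w} l s updates tame s≡ m≡ q≡ P =
        assign⨾ tame (confined P) 5 (lit 0) z≤n λ tame′ →
        weaken ≤-refl (λ (agree , _ , tame″ , P″) → agree , tame″ , progress-⊆ stale-end P″)
          (for Visited (λ (_ , _ , tame″ , P″) → tame″ , confined P″)
            (λ (agree , j≡ , _) → cong₂ (λ j m → suc j ≤ᵇ m) j≡ (trans (agree 3) m≡))
            step (width l N) (+-identityʳ _) ((λ i {i<5} → kept w i {i<5}) , refl , tame′ , P))
        where
        kept : ∀ w i {i<5 : T (i <ᵇ 5)} {x} → (w [ 5 ↦ x ]) i ≡ w i
        kept w i {i<5} = untouched w 5 _ (<⇒≢ (<ᵇ⇒< i 5 i<5))
        Visited : ℕ → Post
        Visited j w′ o′ = Agree w w′ × w′ 5 ≡ j × Tame w′ × Progress (Stale l j) r o′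
        step : ∀ {j w′ o′} → j < width l N → Visited j w′ o′ →
          Outcome (visit block counter ⨾ visit counter block ⨾ word[ lit 5 ]≔ lit 1 ⊕ counter) w′ o′ 25 (Visited (suc j))
        step {w′ = w′} j<m (agree , refl , tame′ , P′) =
          updates 4 5 tame′ s≡′ q<m j<m stale-least P′ ⨾ᵒ λ { (refl , P₁) →
          updates 5 4 tame′ s≡′ j<m q<m (λ D → stale-least (proj₁ D)) P₁ ⨾ᵒ λ { (refl , P₂) →
          assign tame′ (confined P₂) 5 (lit 1 ⊕ counter) (≤-trans (≤-trans j<m (width≤ l N)) (m≤m+n N (N + 0)))
            λ tame″ → (λ i {i<5} → trans (kept w′ i {i<5}) (agree i {i<5})) , refl , tame″ ,
              progress-⊆ stale-step (subst (λ q → Progress (Stale l _ ∖ (l , q , _) ∖ (l , _ , q)) r _) q≡′ P₂) } }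
          where
          s≡′ = trans (agree 2) s≡
          q≡′ = trans (agree 4) q≡
          q<m : w′ 4 < width l N
          q<m = subst (_< width l N) (sym q≡′) (ancestor<width l p<N)

      record Stage (l : ℕ) (w : Words) (o : Objects) : Set a where
        field
          count≡    : w 0 ≡ N
          scale≡    : w 2 ≡ 2 ^ l
          span≡     : w 3 ≡ width l N
          block≡    : w 4 ≡ ancestor l p
          tame      : Tame w
          progress  : Progress (Above l) (table l f 0 0) o
      open Stage

      ascend-outcome : ∀ {w o} l → 1 < width l N → Stage l w o →
        Outcome ascend w o (9 + suc (suc (suc (width (suc l) N * 26 + 1) + 1))) (Stage (suc l))
      ascend-outcome {w} {o} l 1<m S =
        challenges-after (tame S) (literal , literal) result-target
          (patch (confined (progress S)) (answer (progress S)) (λ _ _ → refl))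
          (entries⇓ l (register≡ (scale≡ S)) literal literal) (far 0 1)
          (entries⇓ l (register≡ (scale≡ S)) literal literal) (far 1 0)
          (entries⇓ l (register≡ (scale≡ S)) literal literal) (far 1 1) ⨾ᵒ λ { (refl , π) →
        let P = progress-answer (progress S) (subst (λ e → Patch result e o _)
                  -- As `2 * 0` and `1 + 2 * 0` compute to 0 and 1, these offers are
                  -- `table (suc l) f 0 0` by definition.
                  (offers-cong refl (current 0 1 ≤-refl) (current 1 0 ≤-refl) (current 1 1 (s≤s z≤n))) π)
        in
        assign⨾ (tame S) (confined P) 4 (block ⊘ lit 2) (≤-trans (m/n≤m (w 4) 2) (small (tame S) 4)) λ tame₁ →
        assign⨾ tame₁ (confined P) 3 ((lit 1 ⊕ span) ⊘ lit 2)
          (subst (λ m → (1 + m) / 2 ≤ 2 * N) (sym (span≡ S)) (≤-trans (width≤ (suc l) N) (m≤m+n N (N + 0)))) λ tame₂ →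
        cross-outcome inner (suc l) (2 ^ l) (inner-updates l) tame₂ (scale≡ S)
          (cong (λ m → (1 + m) / 2) (span≡ S)) (cong (_/ 2) (block≡ S)) (progress-⊆ above-next P) ⨾ᵒ λ (agree , tame₃ , P₃) →
        assign tame₃ (confined P₃) 2 (lit 2 ⊗ scale)
          (*-monoʳ-≤ 2 (≤-trans (≤-reflexive (trans (trans (agree 2) (scale≡ S)) (sym (*-identityʳ (2 ^ l)))))
            (<⇒≤ (width-scaled l 1<m)))) λ tame₄ → record
          { count≡    = trans (agree 0) (count≡ S)
          ; scale≡    = cong (2 *_) (trans (agree 2) (scale≡ S))
          ; span≡     = trans (agree 3) (cong (λ m → (1 + m) / 2) (span≡ S))
          ; block≡    = trans (agree 4) (cong (_/ 2) (block≡ S))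
          ; tame      = tame₄
          ; progress  = P₃
          } }
        where
        far : ∀ i j → Apart result (entries l i j)
        far i j = result-apart (3≤entry 0F l i j) (3≤entry 1F l i j)
        current : ∀ i j → 1 ≤ i + j → read o (entries l i j) ≡ table l f i j
        current i j h with fresh (progress S) l i j h
        ... | inj₁ eq = eq
        ... | inj₂ (l<l , _) = contradiction l<l 1+n≰n

      Summit : Post
      Summit w o = ∃ λ l → width l N ≤ 1 × Stage l w o

      -- `k` is fuel for the recursion, whereas the time is measured by the actual width. At width
      -- at most 1 only the failing test remains.
      climb : ∀ {w o} k l → width l N ≤ k → Stage l w o →
        Outcome (while (lit 2 ≤ʷ span) ascend) w o (1 + 164 * pred (width l N)) Summit
      climb {w} {o} k l m≤k S with 2 ≤? width l N
      ... | no  m≱2 = weaken {Q = Summit} (m≤m+n 1 _) (λ q → q) (while-exit (tame S) (confined (progress S))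
                        (trans (cong (2 ≤ᵇ_) (span≡ S)) (≤ᵇ-false (≰⇒> m≱2))) (l , ≤-pred (≰⇒> m≱2) , S))
      climb zero    l m≤k S | yes 2≤m = contradiction (≤-trans 2≤m m≤k) λ ()
      climb {w} {o} (suc k) l m≤k S | yes 2≤m = weaken {Q = Summit} (climb-time m′ 2≤m 0<m′ 2y<m) (λ q → q)
        (while-step (tame S) (confined (progress S)) {Q = Stage (suc l)}
          (trans (cong (2 ≤ᵇ_) (span≡ S)) (≤ᵇ-true 2≤m)) (ascend-outcome l 2≤m S)
          (climb k (suc l) (≤-pred (≤-trans (climb-< m′ 2≤m 2y<m) m≤k))))
        where
        m′ : ℕ
        m′ = width (suc l) N
        0<m′ : 0 < m′
        0<m′ = half-< {1} 2≤m
        2y<m : 2 * pred m′ < width l N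
        2y<m = <-half (≤-reflexive (suc-pred m′ {{>-nonZero 0<m′}}))

      -- The old entries are right for `g`. Beyond the width both tables are blank, and off the row
      -- and the column of `p` they agree by `table-cong`; only the crossing entries are stale, and
      -- the loops rewrite them level by level. `N` bounds both listings, be the set growing or
      -- shrinking.
      refresh-outcome : ∀ {g w o} → (∀ x → N ≤ x → f x ≡ nothing) → (∀ x → N ≤ x → g x ≡ nothing) →
        (∀ x → x ≢ p → f x ≡ g x) → Tame w → Confined o → w 0 ≡ N → w 1 ≡ p →
        (∀ i → o (slot i) ≡ f i) → Tabled g o → Outcome refresh w o (200 * N) Refreshed
      refresh-outcome {g} {w} {o} f-out g-out f≗g tame₀ confined₀ n≡ p≡ listed₀ tabled₀ =
        weaken (refresh-time (≤-trans (s≤s z≤n) p<N)) conclude (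
        assign⨾ tame₀ confined₀ 2 (lit 1) (≤-trans (≤-trans (s≤s z≤n) p<N) (m≤m+n N (N + 0))) λ tame₁ →
        assign⨾ tame₁ confined₀ 3 count (small tame₀ 0) λ tame₂ →
        assign⨾ tame₂ confined₀ 4 position (small tame₀ 1) λ tame₃ →
        clear-outcome tame₃ (literal , literal) result-target confined₀ ⨾ᵒ λ { (refl , π) →
        cross-outcome leaf 0 1 leaf-updates tame₃ refl n≡ p≡ (progress-answer initial-progress π) ⨾ᵒ λ (agree , tame₄ , P) →
        climb N 0 ≤-refl record
          { count≡ = trans (agree 0) n≡ ; scale≡ = agree 2
          ; span≡ = trans (agree 3) n≡ ; block≡ = trans (agree 4) p≡ ; tame = tame₄
          ; progress = subst (λ e → Progress (Above 0) e _) (sym (offer-self (f 0))) P } })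
        where
        initial-progress : Progress (Stale 0 0) (read o result) o
        initial-progress = record { confined = confined₀ ; listed = listed₀ ; answer = refl ; fresh = fresh₀ }
          where
          stale : ∀ l {i j} → Crossing 0 l i j → Stale 0 0 l i j
          stale zero    cross = inj₂ (refl , cross)
          stale (suc l) cross = inj₁ (s≤s z≤n , cross)
          fresh₀ : ∀ l i j → 1 ≤ i + j → read o (entries l i j) ≡ table l f i j ⊎ Stale 0 0 l i j
          fresh₀ l i j h with i <? width l N | j <? width l N | i ≟ ancestor l p | j ≟ ancestor l p
          ... | no i≮  | _      | _        | _        = inj₁ (trans (tabled₀ l i j h)
            (trans (table-blank l g-out (inj₁ (≮⇒≥ i≮))) (sym (table-blank l f-out (inj₁ (≮⇒≥ i≮))))))
          ... | yes _  | no j≮  | _        | _        = inj₁ (trans (tabled₀ l i j h)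
            (trans (table-blank l g-out (inj₂ (≮⇒≥ j≮))) (sym (table-blank l f-out (inj₂ (≮⇒≥ j≮))))))
          ... | yes _  | yes j< | yes refl | _        = inj₂ (stale l (row z≤n j<))
          ... | yes i< | yes _  | no _     | yes refl = inj₂ (stale l (column z≤n i<))
          ... | yes _  | yes _  | no i≢    | no j≢    =
            inj₁ (trans (tabled₀ l i j h) (sym (table-cong l p f≗g i≢ j≢)))
        conclude : ∀ {w′ o′} → Summit w′ o′ → Refreshed w′ o′
        conclude {o′ = o′} (l , narrow′ , S) = record
          { count≡ = count≡ S ; tame = tame S ; solved = record
            { confined = confined (progress S) ; listed = listed (progress S) ; tabled = tabled′
            ; level = l ; narrow = narrow′ ; answer = answer (progress S) } }
          where
          tabled′ : Tabled f o′
          tabled′ l′ i j h with fresh (progress S) l′ i j h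
          ... | inj₁ eq = eq
          -- Levels above the summit were never visited, but they have width at most 1, where no
          -- entry other than the origin lies inside.
          ... | inj₂ (l<l′ , cross) with i< , j< ← crossing-inside cross =
            contradiction (width≤1 (≤⇒≤′ (<⇒≤ l<l′)) narrow′) (<⇒≱ (1<width i< j< h))

-- Enumerations of the current set

module _ {a} {A : Set a} {x : A} where
  ∈-─⁻ : ∀ {S y} (x∈S : x ∈ S) → y ∈ (S ─ x∈S) → y ∈ S
  ∈-─⁻ (here _)    y∈         = there y∈
  ∈-─⁻ (there x∈S) (here eq)  = here eq
  ∈-─⁻ (there x∈S) (there y∈) = there (∈-─⁻ x∈S y∈)

  ∈-─⁺ : ∀ {S y} (x∈S : x ∈ S) → y ≢ x → y ∈ S → y ∈ (S ─ x∈S)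
  ∈-─⁺ (here refl) y≢x (here refl) = contradiction refl y≢x
  ∈-─⁺ (here refl) y≢x (there y∈)  = y∈
  ∈-─⁺ (there x∈S) y≢x (here eq)   = here eq
  ∈-─⁺ (there x∈S) y≢x (there y∈)  = there (∈-─⁺ x∈S y≢x y∈)

  ∉-─ : ∀ {S} (x∈S : x ∈ S) → Unique S → ∀ {y} → y ∈ (S ─ x∈S) → y ≢ x
  ∉-─ (here refl) (fresh ∷ _) y∈         refl = All¬⇒¬Any fresh y∈
  ∉-─ (there x∈S) (fresh ∷ _) (here refl) refl = All¬⇒¬Any fresh x∈S
  ∉-─ (there x∈S) (_ ∷ u)     (there y∈) y≡x  = ∉-─ x∈S u y∈ y≡x

  Unique-─ : ∀ {S} (x∈S : x ∈ S) → Unique S → Unique (S ─ x∈S)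
  Unique-─ (here _)    (_ ∷ u)     = u
  Unique-─ (there x∈S) (fresh ∷ u) = All.tabulate (λ z∈ → All.lookup fresh (∈-─⁻ x∈S z∈)) ∷ Unique-─ x∈S u

  length-─ : ∀ {S} (x∈S : x ∈ S) → length S ≡ suc (length (S ─ x∈S))
  length-─ {S} x∈S = length-removeAt′ S (index x∈S)

module Enumerations {a} {A : Set a} where
  record Enumerates (S : List A) (f : ℕ → Maybe A) : Set a where
    field
      unique    : Unique S
      sound     : ∀ {i y} → f i ≡ just y → y ∈ S
      complete  : ∀ {y} → y ∈ S → ∃ λ i → i < length S × f i ≡ just y
      injective : ∀ {i j y} → f i ≡ just y → f j ≡ just y → i ≡ j
      outside   : ∀ i → length S ≤ i → f i ≡ nothing
  open Enumerates public

  inside : ∀ {S f i y} → Enumerates S f → f i ≡ just y → i < length S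
  inside E fi = ≰⇒> λ h → case (trans (sym fi) (outside E _ h))
    where
    case : ∀ {y} → just y ≢ nothing
    case ()

  enumerates-[] : Enumerates [] (λ _ → nothing)
  enumerates-[] = record { unique = [] ; sound = λ () ; complete = λ () ; injective = λ () ; outside = λ _ _ → refl }

  append : ∀ {S f x} → Enumerates S f → ¬ x ∈ S → Enumerates (x ∷ S) (f [ length S ↦ just x ])
  append {S} {f} {x} E x∉S = record
    { unique    = ¬Any⇒All¬ S x∉S ∷ unique E
    ; sound     = λ {i} → sound′ i
    ; complete  = complete′
    ; injective = λ {i} {j} → injective′ i j
    ; outside   = λ i h → trans (old (>⇒≢ h)) (outside E i (<⇒≤ h))
    }
    where
    n = length S
    f′ = f [ n ↦ just x ]
    old : ∀ {i} → i ≢ n → f′ i ≡ f i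
    old = untouched f n (just x)
    new : f′ n ≡ just x
    new = updated f n (just x)
    sound′ : ∀ i {y} → f′ i ≡ just y → y ∈ x ∷ S
    sound′ i eq with i ≟ n
    ... | yes refl = here (sym (just-injective (trans (sym new) eq)))
    ... | no i≢n   = there (sound E (trans (sym (old i≢n)) eq))
    complete′ : ∀ {y} → y ∈ x ∷ S → ∃ λ i → i < suc n × f′ i ≡ just y
    complete′ (here refl) = n , ≤-refl , new
    complete′ (there y∈S) with i , i<n , fi ← complete E y∈S = i , m≤n⇒m≤1+n i<n , trans (old (<⇒≢ i<n)) fi
    injective′ : ∀ i j {y} → f′ i ≡ just y → f′ j ≡ just y → i ≡ j
    injective′ i j fi fj with i ≟ n | j ≟ n
    ... | yes refl | yes refl = refl
    ... | no i≢n   | no j≢n   = injective E (trans (sym (old i≢n)) fi) (trans (sym (old j≢n)) fj)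
    ... | yes refl | no j≢n   = contradiction
      (subst (_∈ S) (just-injective (trans (sym fi) new)) (sound E (trans (sym (old j≢n)) fj))) x∉S
    ... | no i≢n   | yes refl = contradiction
      (subst (_∈ S) (just-injective (trans (sym fj) new)) (sound E (trans (sym (old i≢n)) fi))) x∉S

  module _ {S f x p} (E : Enumerates S f) (x∈S : x ∈ S) (fp : f p ≡ just x) where
    private
      n = length (S ─ x∈S)
      f₁ = f [ p ↦ f n ]
      f₂ = f₁ [ n ↦ nothing ]

      -- Traces a surviving object back to its old position: `n` if it was moved into the gap `p`,
      -- and `i` itself otherwise. Testing `i ≟ n` before `i ≟ p` also settles the case where the
      -- deleted object is the last one.
      origin : ∀ i {y} → f₂ i ≡ just y → ∃ λ j → f j ≡ just y × j ≢ p × i ≢ n × (j ≡ n × i ≡ p ⊎ j ≡ i)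
      origin i eq with i ≟ n
      ... | yes refl with () ← trans (sym eq) (updated f₁ n nothing)
      ... | no i≢n with i ≟ p
      ...   | yes refl = n , trans (sym (trans (untouched f₁ n nothing i≢n) (updated f p (f n)))) eq ,
                         ≢-sym i≢n , i≢n , inj₁ (refl , refl)
      ...   | no i≢p   = i , trans (sym (trans (untouched f₁ n nothing i≢n) (untouched f p (f n) i≢p))) eq ,
                         i≢p , i≢n , inj₂ refl

      past : ∀ {j y} → f j ≡ just y → j ≤ n
      past fj = ≤-pred (subst (_ <_) (length-─ x∈S) (inside E fj))

      sound′ : ∀ i {y} → f₂ i ≡ just y → y ∈ (S ─ x∈S)
      sound′ i eq with j , fj , j≢p , _ ← origin i eq =
        ∈-─⁺ x∈S (λ { refl → j≢p (injective E fj fp) }) (sound E fj)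

      complete′ : ∀ {y} → y ∈ (S ─ x∈S) → ∃ λ i → i < n × f₂ i ≡ just y
      complete′ {y} y∈ with complete E (∈-─⁻ x∈S y∈)
      ... | j , _ , fj with j ≟ n
      ...   | yes refl = p , ≤∧≢⇒< (past fp) p≢n ,
                         trans (untouched f₁ n nothing p≢n) (trans (updated f p (f n)) fj)
        where
        p≢n : p ≢ n
        p≢n refl = ∉-─ x∈S (unique E) y∈ (just-injective (trans (sym fj) fp))
      ...   | no j≢n   = j , ≤∧≢⇒< (past fj) j≢n ,
                         trans (untouched f₁ n nothing j≢n) (trans (untouched f p (f n) j≢p) fj)
        where
        j≢p : j ≢ p
        j≢p refl = ∉-─ x∈S (unique E) y∈ (just-injective (trans (sym fj) fp))

      injective′ : ∀ i i′ {y} → f₂ i ≡ just y → f₂ i′ ≡ just y → i ≡ i′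
      injective′ i i′ eq eq′ with origin i eq | origin i′ eq′
      ... | j , fj , _ , i≢n , c | j′ , fj′ , _ , i′≢n , c′ with injective E fj fj′ | c | c′
      ... | refl | inj₁ (_ , refl) | inj₁ (_ , refl) = refl
      ... | refl | inj₁ (refl , _) | inj₂ refl       = contradiction refl i′≢n
      ... | refl | inj₂ refl       | inj₁ (refl , _) = contradiction refl i≢n
      ... | refl | inj₂ refl       | inj₂ refl       = refl

      outside′ : ∀ i → n ≤ i → f₂ i ≡ nothing
      outside′ i n≤i with f₂ i in eq
      ... | nothing = refl
      ... | just y with origin i eq
      ...   | _ , _  , _ , p≢n , inj₁ (_ , refl) = contradiction (past fp) (<⇒≱ (≤∧≢⇒< n≤i (≢-sym p≢n)))
      ...   | _ , fj , _ , i≢n , inj₂ refl       = contradiction (past fj) (<⇒≱ (≤∧≢⇒< n≤i (≢-sym i≢n)))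

    swap-remove : Enumerates (S ─ x∈S) f₂
    swap-remove = record
      { unique = Unique-─ x∈S (unique E) ; sound = λ {i} → sound′ i ; complete = complete′
      ; injective = λ {i} {j} → injective′ i j ; outside = outside′ }

-- Insertion and deletion

module Maintenance {a c ℓ₁ ℓ₂} (X : DistanceSpace a c ℓ₁ ℓ₂) where
  open Machine X
  open Tables X
  open DistanceSpace X using (Object; d) renaming (_≟_ to _≟ᵒ_)
  open Enumerations {A = Object}

  module _ (N : ℕ) where
    open Execution X N
    open Refreshing X N

    provides : ∀ {S f w o} → Enumerates S f → length S ≤ N → ∀ l → width l N ≤ 1 →
      read o result ≡ table l f 0 0 → 2 ≤ length S → Provides ⟨ w , o ⟩ S
    provides {[]} _ _ _ _ _ ()
    provides {_ ∷ []} _ _ _ _ _ (s≤s ())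
    provides {S@(u ∷ v ∷ _)} {f} {w} {o} E n≤N l narrow answer _
      with (u≢v ∷ _) ∷ _ ← unique E =
      answered (table-valid l f 0 0) refl
      where
      top : ∀ {i y} → f i ≡ just y → ancestor l i ≡ 0
      top fi = n<1⇒n≡0 (≤-trans (ancestor<width l (≤-trans (inside E fi) n≤N)) narrow)
      least : ∀ {x y} → x ∈ S → y ∈ S → x ≢ y → leq (value (table l f 0 0)) (just (d x y)) ≡ true
      least {x} {y} x∈S y∈S x≢y with i , _ , fi ← complete E x∈S | j , _ , fj ← complete E y∈S =
        subst₂ (λ i j → leq (value (table l f i j)) (just (d x y)) ≡ true) (top fi) (top fj)
          (table-minimal l f fi fj x≢y)
      answered : ∀ {e} → Valid f e → table l f 0 0 ≡ e → Provides ⟨ w , o ⟩ S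
      -- A blank answer has value +∞, which cannot be at most the distance of the two distinct
      -- objects `u` and `v`.
      answered blank eq with () ← trans (sym (cong (λ e → leq (value e) (just (d u v))) eq))
                                        (least (here refl) (there (here refl)) u≢v)
      answered (pair {s} {t} fi fj s≢t) eq = s , t , cong proj₁ (trans answer eq) , cong proj₂ (trans answer eq) , record
        { s∈S = sound E fi ; t∈S = sound E fj ; distinct = s≢t
        ; minimal = λ x∈S y∈S x≢y → leq-just (subst (λ e → leq (value e) (just (d _ _)) ≡ true) eq (least x∈S y∈S x≢y)) }

    -- `M` is the limit of the preceding update and may exceed `N` when the set has shrunk. The
    -- extra cells are blank because the listing ends before `N` and the tables are those of that
    -- listing.
    confine : ∀ {M f o} → Execution.Confined X M o → (∀ i → o (slot i) ≡ f i) → Tabled f o →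
      (∀ i → N ≤ i → f i ≡ nothing) → Confined o
    confine {M} {f} {o} confined listed tabled out c = checked (confined c)
      where
      blank-entry : ∀ b l {i j} → 1 ≤ i + j → width l N ≤ i ⊎ width l N ≤ j → o (entry b l i j) ≡ nothing
      blank-entry 0F l h beyond = cong proj₁ (trans (tabled l _ _ h) (table-blank l out beyond))
      blank-entry 1F l h beyond = cong proj₂ (trans (tabled l _ _ h) (table-blank l out beyond))
      checked : ∀ {c} → o c ≡ nothing ⊎ Used M c → o c ≡ nothing ⊎ Used N c
      checked (inj₁ eq) = inj₁ eq
      checked (inj₂ (reserved c<3)) = inj₂ (reserved c<3)
      checked (inj₂ (slotted {i} _)) with i <? N
      ... | yes i<N = inj₂ (slotted i<N)
      ... | no i≮N  = inj₁ (trans (listed i) (out i (≮⇒≥ i≮N)))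
      checked (inj₂ (entered b l {i} {j} _ _ h)) with i <? width l N | j <? width l N
      ... | yes i< | yes j< = inj₂ (entered b l i< j< h)
      ... | no i≮  | _      = inj₁ (blank-entry b l h (inj₁ (≮⇒≥ i≮)))
      ... | yes _  | no j≮  = inj₁ (blank-entry b l h (inj₂ (≮⇒≥ j≮)))

    within : ∀ {k n σ} → 300 ≤ k → N ≤ 1 + n → Safe σ → Within k n σ
    within {k} {n} 300≤k N≤ (tame , confined , unset) = record
      { word-blank     = λ i h → unused tame i (≤-trans (≤-trans (m≤m+n 6 294) (≤-trans (m≤m*n 300 (1 + n ^ 2)) grow)) h)
      ; object-blank   = λ i h → far i (≤-trans grow h) (confined i)
      ; distance-blank = λ i _ → unset i
      -- Through `2 * N ≤ 2 * (1 + n) ≤ (2 + n) ^ 2`.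
      ; word-small     = λ i → ≤-trans (small tame i) (≤-trans (*-monoʳ-≤ 2 N≤) (≤-trans
          (*-mono-≤ (m≤m+n 2 n) (≤-trans (n≤1+n (1 + n)) (m≤m*n (2 + n) 1)))
          (^-monoʳ-≤ (2 + n) (≤-trans (m≤m+n 2 298) 300≤k))))
      }
      where
      grow : 300 * (1 + n ^ 2) ≤ k * (1 + n ^ 2)
      grow = *-monoˡ-≤ (1 + n ^ 2) 300≤k
      far : ∀ {x : Maybe Object} i → 300 * (1 + n ^ 2) ≤ i → x ≡ nothing ⊎ Used N i → x ≡ nothing
      far i h (inj₁ eq)   = eq
      far i h (inj₂ used) = contradiction h (<⇒≱ (Used-bound N≤ used))

    module _ {o : Objects} where
      list-slot : ∀ {f : ℕ → Maybe Object} j v → (∀ i → o (slot i) ≡ f i) →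
        ∀ i → (o [ slot j ↦ v ]) (slot i) ≡ (f [ j ↦ v ]) i
      list-slot {f} j v listed i with i ≟ j
      ... | yes refl = trans (updated o (slot j) v) (sym (updated f j v))
      ... | no i≢j   = trans (untouched o (slot j) v (λ eq → i≢j (slot-injective eq)))
                             (trans (listed i) (sym (untouched f j v i≢j)))

      table-slot : ∀ {f} j v → Tabled f o → Tabled f (o [ slot j ↦ v ])
      table-slot j v tabled l i k h = trans
        (cong₂ _,_ (untouched o (slot j) v (≢-sym (slot≢entry {j} {0F} {l} {i} {k})))
                   (untouched o (slot j) v (≢-sym (slot≢entry {j} {1F} {l} {i} {k})))) (tabled l i k h)

      list-input : ∀ {f : ℕ → Maybe Object} v → (∀ i → o (slot i) ≡ f i) → ∀ i → (o [ 0 ↦ v ]) (slot i) ≡ f i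
      list-input v listed i = trans (untouched o 0 v (>⇒≢ (≤-trans (s≤s z≤n) (3≤slot i)))) (listed i)

      table-input : ∀ {f} v → Tabled f o → Tabled f (o [ 0 ↦ v ])
      table-input v tabled l i k h = trans
        (cong₂ _,_ (untouched o 0 v (>⇒≢ (≤-trans (s≤s z≤n) (3≤entry 0F l i k))))
                   (untouched o 0 v (>⇒≢ (≤-trans (s≤s z≤n) (3≤entry 1F l i k))))) (tabled l i k h)

    reset-outcome : ∀ {w o} → Tame w → Confined o →
      Outcome reset w o 5 λ w′ o′ → w′ 0 ≡ w 0 × (∀ i → w′ (suc i) ≡ 0) × o′ ≡ o
    reset-outcome {w} {o} tame confined =
      assign⨾ tame confined 1 (lit 0) z≤n λ tame₁ →
      assign⨾ tame₁ confined 2 (lit 0) z≤n λ tame₂ →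
      assign⨾ tame₂ confined 3 (lit 0) z≤n λ tame₃ →
      assign⨾ tame₃ confined 4 (lit 0) z≤n λ tame₄ →
      assign tame₄ confined 5 (lit 0) z≤n λ tame₅ → refl , zeros tame₅ , refl
      where
      zeros : ∀ {w : Words} → Tame (((((w [ 1 ↦ 0 ]) [ 2 ↦ 0 ]) [ 3 ↦ 0 ]) [ 4 ↦ 0 ]) [ 5 ↦ 0 ]) →
        ∀ i → (((((w [ 1 ↦ 0 ]) [ 2 ↦ 0 ]) [ 3 ↦ 0 ]) [ 4 ↦ 0 ]) [ 5 ↦ 0 ]) (suc i) ≡ 0
      zeros tame 0 = refl
      zeros tame 1 = refl
      zeros tame 2 = refl
      zeros tame 3 = refl
      zeros tame 4 = refl
      zeros tame (suc (suc (suc (suc (suc i))))) = unused tame (6 + i) (m≤m+n 6 i)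

    module _ {f : ℕ → Maybe Object} {x : Object} (i : ℕ) (i<N : i < N) (fi : f i ≡ just x) where
      Found : Words → Objects → Post
      Found w o w′ o′ = w′ 0 ≡ w 0 × f (w′ 1) ≡ just x × w′ 1 < N × Tame w′ × o′ ≡ o

      -- Some position `i` is known to hold `x`, and `k` is the distance to it. The scan stops there
      -- at the latest, and whatever position it stops at will do.
      search-outcome : ∀ k {w o} → k + w 1 ≡ i → Tame w → Confined o → (∀ i → o (slot i) ≡ f i) → o 0 ≡ just x →
        Outcome search w o (1 + 2 * k) (Found w o)
      search-outcome k {w} {o} k+p≡i tame confined listed input = decided k k+p≡i (≡-dec _≟ᵒ_ (f (w 1)) (just x)) refl
        where
        test : ∀ {result} → ≡-dec _≟ᵒ_ (f (w 1)) (just x) ≡ result →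
          ⟦ ¬ᵗ (object[ slotᵉ position ] ≐ᵒ object[ lit 0 ]) ⟧ᵗ ⟨ w , o ⟩ ≡ not ⌊ result ⌋
        test eq = trans (cong₂ (λ s t → not ⌊ ≡-dec _≟ᵒ_ s t ⌋)
          (trans (cong o (value-at (slot⇓ {w} {position} register) o)) (listed (w 1))) input) (cong (λ b → not ⌊ b ⌋) eq)
        p≤i : w 1 ≤ i
        p≤i = ≤-trans (m≤n+m (w 1) k) (≤-reflexive k+p≡i)
        decided : ∀ k → k + w 1 ≡ i → (decision : Dec (f (w 1) ≡ just x)) → ≡-dec _≟ᵒ_ (f (w 1)) (just x) ≡ decision →
          Outcome search w o (1 + 2 * k) (Found w o)
        decided k _ (yes fp) eq = weaken {Q = Found w o} (m≤m+n 1 (2 * k)) (λ q → q)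
          (while-exit tame confined (test eq) (refl , fp , ≤-<-trans p≤i i<N , tame , refl))
        decided zero refl (no fp≢) _ = contradiction fi fp≢
        decided (suc k) k+p≡i (no fp≢) eq = weaken {Q = Found w o} (≤-reflexive (cong suc (sym (*-suc 2 k)))) (λ q → q)
          (while-step tame confined {Q = λ w′ o′ → w′ ≡ w [ 1 ↦ suc (w 1) ] × o′ ≡ o × Tame w′} (test eq)
            (assign tame confined 1 (lit 1 ⊕ position)
              (≤-trans (s≤s p≤i) (≤-trans i<N (m≤m+n N (N + 0)))) λ tame′ → refl , refl , tame′)
            λ { (refl , refl , tame′) →
              search-outcome k (trans (+-suc k (w 1)) k+p≡i) tame′ confined listed input })

  -- The invariant between updates

  module E (N : ℕ) = Execution X N

  -- Clearing the other registers between updates prevents values of the order of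
  -- an earlier, larger size from violating the word bound as the set shrinks.
  record Maintained (S : List Object) (σ : State) : Set (a ⊔ c ⊔ ℓ₂) where
    constructor maintained
    field
      {limit}    : ℕ
      {words}    : E.Words limit
      {objects}  : E.Objects limit
      {contents} : ℕ → Maybe Object
      state      : σ ≡ E.⟨_,_⟩ limit words objects
      size       : words 0 ≡ length S
      idle       : ∀ i → words (suc i) ≡ 0
      enumerates : Enumerates S contents
      listed     : ∀ i → objects (slot i) ≡ contents i
      tabled     : Refreshing.Tabled X limit contents objects
      confined   : E.Confined limit objects
      provided   : 2 ≤ length S → Provides σ S

  maintained-initial : Maintained [] initial
  maintained-initial = maintained {limit = 0} refl refl (λ _ → refl) enumerates-[] (λ _ → refl)
    (λ l i j _ → sym (table-blank l (λ _ _ → refl) (inj₁ (≤-trans (width≤ l 0) z≤n)))) (λ _ → inj₁ refl) λ ()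

  module _ {k : ℕ} (420≤k : 420 ≤ k) where
    Maintains : Update → State → List Object → Set _
    Maintains u σ S′ = ∃₂ λ τ σ′ → Performs quadtree u σ τ σ′ ×
      length τ ≤ k * (1 + length S′) × All (Within k (length S′)) τ × Maintained S′ σ′

    module _ (N : ℕ) where
      open Execution X N
      open Refreshing X N

      tame-idle : ∀ {w} → w 0 ≤ 2 * N → (∀ i → w (suc i) ≡ 0) → Tame w
      tame-idle {w} w₀≤ idle = record { small = small′ ; unused = λ { (suc i) _ → idle i } }
        where
        small′ : ∀ i → w i ≤ 2 * N
        small′ zero    = w₀≤
        small′ (suc i) = ≤-trans (≤-reflexive (idle i)) z≤n

      Settled : List Object → Post
      Settled S w o = w 0 ≡ length S × (∀ i → w (suc i) ≡ 0) × ∃ λ f → Enumerates S f × Solved f o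

      settled : ∀ {S w o} → length S ≤ N → Settled S w o → Maintained S ⟨ w , o ⟩
      settled {w = w} {o} n≤N (size , idle , f , E , s) = maintained {limit = N} {w} refl size idle E listed tabled confined
        (provides N {w = w} {o} E n≤N level narrow answer)
        where open Solved s

      position-slot : ∀ w o → ⟦ slotᵉ position ⟧ʷ ⟨ w , o ⟩ ≡ slot (w 1)
      position-slot w = value-at (slot⇓ {w} {position} register)

      last-slot : ∀ {n} w o → w 0 ≡ suc n → ⟦ slotᵉ (count ⊖ lit 1) ⟧ʷ ⟨ w , o ⟩ ≡ slot n
      last-slot w o eq = value-at (slot⇓ {w} {count ⊖ lit 1} (evaluated λ _ → cong (_∸ 1) eq)) o

      settle : ∀ {S f w o} → w 0 ≡ length S → Tame w → Enumerates S f → Solved f o → Outcome reset w o 5 (Settled S)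
      settle {f = f} size tame E s = weaken ≤-refl (λ { (eq , idle , refl) → trans eq size , idle , f , E , s })
        (reset-outcome N tame (Solved.confined s))

      finish : ∀ {u σ S′ w o t} → supply u σ ≡ ⟨ w , o ⟩ → length S′ ≤ N → N ≤ 1 + length S′ → t ≤ k * (1 + length S′) →
        Outcome (program quadtree u) w o t (Settled S′) → Maintains u σ S′
      finish {u} {S′ = S′} eq n≤N N≤ t≤ (outcome {trace = τ} {w′} {o′} r h s q) = τ , ⟨ w′ , o′ ⟩ ,
        subst (λ σ → Run (program quadtree u) σ τ ⟨ w′ , o′ ⟩) (sym eq) r , ≤-trans h t≤ ,
        All.map (within N (≤-trans (m≤m+n 300 120) 420≤k) N≤) s , settled n≤N q

    insertion : ∀ {S σ x} → Maintained S σ → ¬ x ∈ S → Maintains (insert x) σ (x ∷ S)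
    insertion {S} {x = x} (maintained {M} {w} {o} {f} refl size idle enum listed tabled confined _) x∉S =
      finish N {insert x} refl ≤-refl (n≤1+n N) time (
      assign⨾ tame₀ confined₀ 1 count (small tame₀ 0) λ tame₁ →
      store⨾ tame₁ confined₀ {e = slotᵉ position} {f = object[ lit 0 ]}
        (trans (position-slot N (w [ 1 ↦ w 0 ]) o₀) (cong slot size)) refl (slotted ≤-refl) λ confined₁ →
      assign⨾ tame₁ confined₁ 0 (lit 1 ⊕ count)
        (≤-trans (≤-reflexive (cong suc size)) (m≤m+n N (N + 0))) λ tame₂ →
      refresh-outcome f′ n ≤-refl (outside enum′) (λ i h → outside enum i (<⇒≤ h)) (λ i → untouched f n (just x))
        tame₂ confined₁ (cong suc size) size
        (list-slot N {o₀} n (just x) listed₀) (table-slot N {o₀} n (just x) tabled₀) ⨾ᵒ λ R →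
      settle N {x ∷ S} (Refreshed.count≡ R) (Refreshed.tame R) enum′ (Refreshed.solved R))
      where
      n = length S
      N = suc n
      open Execution X N
      open Refreshing X N
      f′ = f [ n ↦ just x ]
      enum′ = append enum x∉S
      tame₀ : Tame w
      tame₀ = tame-idle N (≤-trans (≤-reflexive size) (≤-trans (n≤1+n n) (m≤m+n N (N + 0)))) idle
      o₀ = o [ 0 ↦ just x ]
      confined₀ : Confined o₀
      confined₀ = stored tame₀ (confine N {M} confined listed tabled (λ i h → outside enum i (<⇒≤ h))) (reserved (s≤s z≤n))
      listed₀ : ∀ i → o₀ (slot i) ≡ f i
      listed₀ = list-input N {o} (just x) listed
      tabled₀ : Tabled f o₀
      tabled₀ = table-input N {o} (just x) tabled
      time : 3 + (200 * N + 5) ≤ k * (1 + N)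
      time = begin
        3 + (200 * N + 5)          ≤⟨ m≤m+n _ 192 ⟩
        3 + (200 * N + 5) + 192    ≡⟨ collect N ⟩
        200 * (1 + N)              ≤⟨ *-monoˡ-≤ (1 + N) (≤-trans (m≤m+n 200 220) 420≤k) ⟩
        k * (1 + N)                ∎
        where
        open ≤-Reasoning
        collect : ∀ N → 3 + (200 * N + 5) + 192 ≡ 200 * (1 + N)
        collect = solve-∀

    deletion : ∀ {S σ x} → Maintained S σ → (x∈S : x ∈ S) → Maintains (delete x) σ (S ─ x∈S)
    deletion {S} {x = x} (maintained {M} {w} {o} {f} refl size idle enum listed tabled confined _) x∈S
      = finish N {delete x} refl (n≤1+n n) ≤-refl time (
      search-outcome N i i<N fi i (trans (cong (i +_) (idle 0)) (+-identityʳ i)) tame₀ confined₀ listed₀ refl ⨾ᵒ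
      λ { {w₁} (count≡₁ , fp , p<N , tame₁ , refl) →
      let p = w₁ 1
          f₁ = f [ p ↦ f n ]
          size₁ = trans count≡₁ size′
          enum′ = swap-remove enum x∈S fp
          out₁ = λ i h → trans (untouched f p (f n) (>⇒≢ (≤-trans p<N h))) (out i h)
      in
      store⨾ tame₁ confined₀ {e = slotᵉ position} {f = object[ slotᵉ (count ⊖ lit 1) ]}
        (position-slot N w₁ o₀)
        (trans (cong o₀ (last-slot N w₁ o₀ size₁)) (listed₀ n))
        (slotted p<N) λ confined₁ →
      refresh-outcome f₁ p p<N out₁ out (λ i → untouched f p (f n)) tame₁ confined₁ size₁ refl
        (list-slot N {o₀} p (f n) listed₀) (table-slot N {o₀} p (f n) tabled₀) ⨾ᵒ λ { {w₂} {o₂} R →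
      store⨾ (Refreshed.tame R) (Solved.confined (Refreshed.solved R)) {e = slotᵉ (count ⊖ lit 1)} {f = blank}
        (last-slot N w₂ o₂ (Refreshed.count≡ R)) refl (slotted ≤-refl) λ confined₂ →
      assign⨾ (Refreshed.tame R) confined₂ 1 (count ⊖ lit 1)
        (≤-trans (≤-reflexive (last (Refreshed.count≡ R))) (≤-trans (n≤1+n n) (m≤m+n N (N + 0)))) λ tame₃ →
      refresh-outcome (f₁ [ n ↦ nothing ]) n ≤-refl (λ i h → outside enum′ i (<⇒≤ h)) out₁ (λ i → untouched f₁ n nothing)
        tame₃ confined₂ (Refreshed.count≡ R) (last (Refreshed.count≡ R))
        (list-slot N {o₂} n nothing (Solved.listed (Refreshed.solved R)))
        (table-slot N {o₂} n nothing (Solved.tabled (Refreshed.solved R))) ⨾ᵒ λ R′ →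
      assign⨾ (Refreshed.tame R′) (Solved.confined (Refreshed.solved R′)) 0 (count ⊖ lit 1)
        (≤-trans (≤-reflexive (last (Refreshed.count≡ R′))) (≤-trans (n≤1+n n) (m≤m+n N (N + 0)))) λ tame₄ →
      settle N {S ─ x∈S} (last (Refreshed.count≡ R′)) tame₄ enum′ (Refreshed.solved R′) } })
      where
      n = length (S ─ x∈S)
      N = suc n
      last : ∀ {m} → m ≡ N → m ∸ 1 ≡ n
      last = cong (_∸ 1)
      open Execution X N
      open Refreshing X N
      occurrence = complete enum x∈S
      i = proj₁ occurrence
      i<S = proj₁ (proj₂ occurrence)
      fi = proj₂ (proj₂ occurrence)
      size′ = trans size (length-─ x∈S)
      i<N : i < N
      i<N = subst (i <_) (length-─ x∈S) i<S
      out : ∀ i → N ≤ i → f i ≡ nothing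
      out i h = outside enum i (≤-trans (≤-reflexive (length-─ x∈S)) h)
      tame₀ : Tame w
      tame₀ = tame-idle N (≤-trans (≤-reflexive size′) (m≤m+n N (N + 0))) idle
      o₀ = o [ 0 ↦ just x ]
      confined₀ : Confined o₀
      confined₀ = stored tame₀ (confine N {M} confined listed tabled out) (reserved (s≤s z≤n))
      listed₀ : ∀ i → o₀ (slot i) ≡ f i
      listed₀ = list-input N {o} (just x) listed
      tabled₀ : Tabled f o₀
      tabled₀ = table-input N {o} (just x) tabled
      -- Two refreshes of `200 * (1 + n)` steps, a search of at most `1 + 2 * n` and a few
      -- assignments make `402 * n + 410`; hence the constant 420.
      time : 1 + 2 * i + suc (200 * N + suc (suc (200 * N + suc 5))) ≤ k * (1 + n)
      time = begin
        1 + 2 * i + searched  ≤⟨ +-monoˡ-≤ searched (s≤s (*-monoʳ-≤ 2 (≤-pred i<N))) ⟩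
        1 + 2 * n + searched  ≤⟨ m≤m+n _ (10 + 18 * n) ⟩
        1 + 2 * n + searched + (10 + 18 * n)  ≡⟨ collect n ⟩
        420 * (1 + n)         ≤⟨ *-monoˡ-≤ (1 + n) 420≤k ⟩
        k * (1 + n)           ∎
        where
        open ≤-Reasoning
        searched = suc (200 * N + suc (suc (200 * N + suc 5)))
        collect : ∀ n → 1 + 2 * n + suc (200 * suc n + suc (suc (200 * suc n + suc 5))) + (10 + 18 * n) ≡ 420 * (1 + n)
        collect = solve-∀

    maintains : ∀ {S S′ σ u} → Maintained S σ → S ─⟨ u ⟩→ S′ → Maintains u σ S′
    maintains M (insert x∉S) = insertion M x∉S
    maintains M (delete x∈S) = deletion M x∈S

    -- The run in `Reachable` is an arbitrary one; determinism identifies it with the run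
    -- constructed here, so that the invariant passes to its final state.
    reachable-maintained : ∀ {S σ} → Reachable quadtree S σ → Maintained S σ
    reachable-maintained start = maintained-initial
    reachable-maintained (update r s run) with _ , _ , run′ , _ , _ , M ← maintains (reachable-maintained r) s
      with refl ← proj₂ (Run-deterministic run run′) = M

theorem2 : ∀ {a c ℓ₁ ℓ₂} →
    ∃[ A ] ∃[ k ] ((X : DistanceSpace a c ℓ₁ ℓ₂) → let open Machine X in
    ∀ {S σ} → Reachable A S σ →
    (2 ≤ length S → Provides σ S) ×
    (∀ {u S′} → S ─⟨ u ⟩→ S′ →
    ∃[ τ ] ∃[ σ′ ] (Performs A u σ τ σ′ ×
    length τ ≤ k * (1 + length S′) ×
    All (Within k (length S′)) τ)))
theorem2 = quadtree , 420 , λ X r →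
  let open Maintenance X
      M = reachable-maintained {420} ≤-refl r
  in Maintained.provided M , λ s →
     let τ , σ′ , run , time , safe , _ = maintains ≤-refl M s in τ , σ′ , run , time , safe
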